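{- Let $K$ be a field with algebraic closure $\overline{K}$, let $f\in K(x)$ be nonzero, and let $d$ be the greatest proper divisor of $\deg f$ (the largest positive divisor of $\deg f$ smaller than $\deg f$). If $\operatorname{ord}_\infty f\neq 0$ and $\operatorname{ord}_\infty f$ is divisible by a prime $p>d$, then $f$ is prime over $\overline{K}$.
   Context: For $u\in K(x)\setminus\{0\}$ written as $u=u_1/u_2$ with $u_1,u_2\in K[x]$ coprime, $\deg u=\max\{\deg u_1,\deg u_2\}$ and $\operatorname{ord}_\infty u=\deg u_2-\deg u_1$. For a field extension $L/K$, $f\in K(x)$ is composite over $L$ if $f=g\circ h$ with $g,h\in L(x)$, $\deg g\ge 2$, $\deg h\ge 2$; otherwise $f$ is prime over $L$. -}

module Defs where

open import Level using (Level; _⊔_; suc)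
open import Data.Nat as ℕ using (ℕ; zero; _∸_; _<_; _≤_)
open import Data.Nat.Divisibility as ℕD using ()
open import Data.Integer as ℤ using (ℤ)
open import Data.List using (List; []; _∷_; map)
open import Data.Product using (Σ; ∃; _×_; _,_)
open import Relation.Nullary using (¬_)
open import Algebra.Bundles using (CommutativeRing)
open import Algebra.Morphism.Structures using (module RingMorphisms)

record Field (c ℓ : Level) : Set (suc (c ⊔ ℓ)) where
  field
    commutativeRing : CommutativeRing c ℓ
  open CommutativeRing commutativeRing public
  field
    1≉0     : ¬ (1# ≈ 0#)
    inverse : ∀ x → ¬ (x ≈ 0#) → ∃ λ y → x * y ≈ 1#

-- Univariate polynomials over a commutative ring, as coefficient lists
-- (constant coefficient first).  Equality is coefficientwise, so
-- trailing zeros are irrelevant.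

module Poly {c ℓ} (R : CommutativeRing c ℓ) where
  open CommutativeRing R

  Pol : Set c
  Pol = List Carrier

  coeff : Pol → ℕ → Carrier
  coeff []       _       = 0#
  coeff (a ∷ p)  zero    = a
  coeff (a ∷ p)  (ℕ.suc n) = coeff p n

  _≈ₚ_ : Pol → Pol → Set ℓ
  p ≈ₚ q = ∀ n → coeff p n ≈ coeff q n

  IsZero : Pol → Set ℓ
  IsZero p = ∀ n → coeff p n ≈ 0#

  _+ₚ_ : Pol → Pol → Pol
  []      +ₚ q       = q
  (a ∷ p) +ₚ []      = a ∷ p
  (a ∷ p) +ₚ (b ∷ q) = (a + b) ∷ (p +ₚ q)

  _*ₚ_ : Pol → Pol → Pol
  []      *ₚ q = []
  (a ∷ p) *ₚ q = map (a *_) q +ₚ (0# ∷ (p *ₚ q))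

  const : Carrier → Pol
  const a = a ∷ []

  oneₚ : Pol
  oneₚ = const 1#

  _^ₚ_ : Pol → ℕ → Pol
  p ^ₚ zero    = oneₚ
  p ^ₚ ℕ.suc n = p *ₚ (p ^ₚ n)

  eval : Pol → Carrier → Carrier
  eval []      y = 0#
  eval (a ∷ p) y = a + y * eval p y

  -- deg p = n  (the zero polynomial has no degree)
  HasDeg : Pol → ℕ → Set ℓ
  HasDeg p n = ¬ (coeff p n ≈ 0#) × (∀ m → n < m → coeff p m ≈ 0#)

  _∣ₚ_ : Pol → Pol → Set (c ⊔ ℓ)
  p ∣ₚ q = ∃ λ r → (p *ₚ r) ≈ₚ q

  Coprime : Pol → Pol → Set (c ⊔ ℓ)
  Coprime p q = ∀ r → r ∣ₚ p → r ∣ₚ q → HasDeg r 0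

  homogAux : Pol → ℕ → Pol → Pol → ℕ → Pol
  homogAux p N h₁ h₂ zero      = const (coeff p 0) *ₚ (h₂ ^ₚ N)
  homogAux p N h₁ h₂ (ℕ.suc k) =
    homogAux p N h₁ h₂ k
      +ₚ ((const (coeff p (ℕ.suc k)) *ₚ (h₁ ^ₚ ℕ.suc k)) *ₚ (h₂ ^ₚ (N ∸ ℕ.suc k)))

  -- h₂^N · p(h₁/h₂)  for N ≥ deg p
  homog : Pol → ℕ → Pol → Pol → Pol
  homog p N h₁ h₂ = homogAux p N h₁ h₂ N

  -- A rational function u₁/u₂ in lowest terms (u₁,u₂ coprime, u₂ ≠ 0)
  -- has degree max(deg u₁, deg u₂).  (Only used for nonzero u₁.)
  RatDeg : Pol → Pol → ℕ → Set (c ⊔ ℓ)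
  RatDeg u₁ u₂ n =
    Coprime u₁ u₂ × Σ ℕ λ a → Σ ℕ λ b → HasDeg u₁ a × HasDeg u₂ b × n ≡ a ℕ.⊔ b
    where open import Relation.Binary.PropositionalEquality using (_≡_)

module _ {c₁ ℓ₁ c₂ ℓ₂} (K : Field c₁ ℓ₁) (L : Field c₂ ℓ₂) where
  private
    module K = Field K
    module L = Field L
    module PK = Poly K.commutativeRing
    module PL = Poly L.commutativeRing
  open RingMorphisms K.rawRing L.rawRing using (IsRingHomomorphism)

  record IsAlgebraicClosure (ι : K.Carrier → L.Carrier) : Set (c₁ ⊔ ℓ₁ ⊔ c₂ ⊔ ℓ₂) where
    field
      isRingHom   : IsRingHomomorphism ι
      algClosed   : ∀ (p : PL.Pol) n → PL.HasDeg p n → 1 ≤ n →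
                    ∃ λ y → PL.eval p y L.≈ L.0#
      algebraic   : ∀ (y : L.Carrier) → ∃ λ (p : PK.Pol) →
                    ¬ PK.IsZero p × PL.eval (map ι p) y L.≈ L.0#

-- f = f₁/f₂ ∈ K(x) (given by polynomials over L) is composite over L:
-- f = g ∘ h with g = g₁/g₂, h = h₁/h₂ ∈ L(x) (in lowest terms),
-- deg g ≥ 2, deg h ≥ 2.  With N = deg g, g ∘ h equals
-- (h₂^N g₁(h₁/h₂)) / (h₂^N g₂(h₁/h₂)), and f = g ∘ h means
-- f₁ · D ≈ f₂ · Nm with D ≠ 0.

module _ {c ℓ} (L : Field c ℓ) where
  private
    module L = Field L
  open Poly L.commutativeRing

  CompositeOver : Pol → Pol → Set (c ⊔ ℓ)
  CompositeOver f₁ f₂ =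
    Σ Pol λ g₁ → Σ Pol λ g₂ → Σ Pol λ h₁ → Σ Pol λ h₂ →
    Σ ℕ λ m → Σ ℕ λ n →
      RatDeg g₁ g₂ m × 2 ≤ m ×
      RatDeg h₁ h₂ n × 2 ≤ n ×
      ¬ IsZero (homog g₂ m h₁ h₂) ×
      ((f₁ *ₚ homog g₂ m h₁ h₂) ≈ₚ (f₂ *ₚ homog g₁ m h₁ h₂))

  PrimeOver : Pol → Pol → Set (c ⊔ ℓ)
  PrimeOver f₁ f₂ = ¬ CompositeOver f₁ f₂

GreatestProperDivisor : ℕ → ℕ → Set
GreatestProperDivisor n d =
  d ℕD.∣ n × 0 < d × d < n × (∀ e → e ℕD.∣ n → 0 < e → e < n → e ≤ d)

{-# OPTIONS --safe #-}
module Submission where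

open import Defs
open import Level as Level using (Level)
open import Algebra.Bundles using (CommutativeRing; RawRing)
open import Algebra.Structures using (IsCommutativeRing)
open import Algebra.Morphism.Structures using (IsRingMonomorphism; IsRingHomomorphism)
import Algebra.Construct.Pointwise as Pointwise
import Algebra.Morphism.Construct.Identity as Identity
import Algebra.Morphism.RingMonomorphism as RingMonomorphism
import Algebra.Properties.Ring as RingProperties
import Algebra.Solver.Ring.NaturalCoefficients.Default as SemiringSolver
open import Data.Empty using (⊥)
open import Data.List using ([]; _∷_; map; length)
open import Data.List.Properties using (map-id)
open import Data.Nat as ℕ using (ℕ; zero; suc; _≤_; _<_; _>_; _⊔_; _∸_; z≤n; s≤s)
import Data.Nat.Divisibility as ℕ
open import Data.Nat.Induction using (<-rec)
open import Data.Nat.Primality using (Prime; euclidsLemma)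
import Data.Nat.Properties as ℕ
open import Data.Nat.Solver using (module +-*-Solver)
open import Data.Product using (_×_; _,_; ∃; ∃₂; proj₁; proj₂)
open import Data.Sum using (inj₁; inj₂)
open import Function using (_∘_; id)
open import Relation.Binary.Definitions using (tri<; tri≈; tri>)
open import Relation.Binary.PropositionalEquality as ≡ using (_≡_)
import Relation.Binary.Reasoning.Setoid as SetoidReasoning
open import Relation.Nullary using (¬_; yes; no; contradiction)
open import Relation.Nullary.Decidable using (¬¬-excluded-middle)

-- If f = g ∘ h with deg g = m and deg h = k, then deg f = m k, so m and k are at most d.  Let x = h(∞)
-- be a point of the projective line.  Then ord_∞ f = ± u e, where u ≤ m is the order of the zero or
-- pole of g at x and e ≤ k is the multiplicity with which h takes the value x at ∞.  A prime p > d
-- dividing u e divides u or e, hence that factor is 0 and ord_∞ f = 0.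
--
-- The identity deg f = m k and the formula for ord_∞ f are read off the degrees of N and D below,
-- which requires the fraction N / D = h₂ᵐ g₁(h₁/h₂) / h₂ᵐ g₂(h₁/h₂) to be in lowest terms.  Over an
-- algebraically closed field it suffices that N and D have no common root: at such a root y, g₁ and g₂
-- would both vanish at the point h(y).  Equality in the fields is not assumed decidable, but the goal
-- is a negation, so excluded middle may be used.

-- Polynomials as a commutative ring, and bounds on their degrees.

module PolynomialRing {c ℓ} (R : CommutativeRing c ℓ) where
  open CommutativeRing R hiding (zero)
  open Poly R
  open RingProperties ring using (-0#≈0#)
  open SetoidReasoning setoid
  open SemiringSolver commutativeSemiring using (solve; _:+_; _:*_; _:=_)

  private
    -- Formal power series. The ring laws are proved here, where the product is one recursion on the
    -- index, and are then pulled back to coefficient lists along `coeff`.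
    Seq : Set c
    Seq = ℕ → Carrier

    infix 4 _≐_
    _≐_ : Seq → Seq → Set ℓ
    f ≐ g = ∀ n → f n ≈ g n

    _⊕_ : Seq → Seq → Seq
    (f ⊕ g) n = f n + g n

    _⊛_ : Seq → Seq → Seq
    (f ⊛ g) zero    = f 0 * g 0
    (f ⊛ g) (suc n) = f 0 * g (suc n) + ((f ∘ suc) ⊛ g) n

    0≐ : Seq
    0≐ _ = 0#

    1≐ : Seq
    1≐ = coeff oneₚ

    ⊛-cong : ∀ {f f′ g g′} → f ≐ f′ → g ≐ g′ → (f ⊛ g) ≐ (f′ ⊛ g′)
    ⊛-cong p q zero    = *-cong (p 0) (q 0)
    ⊛-cong p q (suc n) = +-cong (*-cong (p 0) (q (suc n))) (⊛-cong (p ∘ suc) q n)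

    ⊛-zeroˡ : ∀ g → (0≐ ⊛ g) ≐ 0≐
    ⊛-zeroˡ g zero    = zeroˡ _
    ⊛-zeroˡ g (suc n) = trans (+-cong (zeroˡ _) (⊛-zeroˡ g n)) (+-identityˡ _)

    ⊛-distribʳ : ∀ h f g → ((f ⊕ g) ⊛ h) ≐ ((f ⊛ h) ⊕ (g ⊛ h))
    ⊛-distribʳ h f g zero    = distribʳ _ _ _
    ⊛-distribʳ h f g (suc n) = begin
      (f 0 + g 0) * h (suc n) + (((f ∘ suc) ⊕ (g ∘ suc)) ⊛ h) n
        ≈⟨ +-congˡ (⊛-distribʳ h (f ∘ suc) (g ∘ suc) n) ⟩
      (f 0 + g 0) * h (suc n) + (((f ∘ suc) ⊛ h) n + ((g ∘ suc) ⊛ h) n)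
        ≈⟨ solve 5 (λ a b x u v → (a :+ b) :* x :+ (u :+ v) := (a :* x :+ u) :+ (b :* x :+ v))
             refl (f 0) (g 0) (h (suc n)) _ _ ⟩
      (f 0 * h (suc n) + ((f ∘ suc) ⊛ h) n) + (g 0 * h (suc n) + ((g ∘ suc) ⊛ h) n) ∎

    ⊛-scale : ∀ a f g → ((λ n → a * f n) ⊛ g) ≐ (λ n → a * (f ⊛ g) n)
    ⊛-scale a f g zero    = *-assoc _ _ _
    ⊛-scale a f g (suc n) = begin
      a * f 0 * g (suc n) + ((λ m → a * f (suc m)) ⊛ g) n
        ≈⟨ +-cong (*-assoc _ _ _) (⊛-scale a (f ∘ suc) g n) ⟩
      a * (f 0 * g (suc n)) + a * ((f ∘ suc) ⊛ g) n
        ≈⟨ distribˡ _ _ _ ⟨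
      a * (f 0 * g (suc n) + ((f ∘ suc) ⊛ g) n) ∎

    -- Mirror image of the defining recursion of `_⊛_`: the constant term of the second factor is
    -- split off instead of that of the first. Commutativity follows by comparing the two.
    ⊛-unfoldʳ : ∀ f g n → (f ⊛ g) (suc n) ≈ f (suc n) * g 0 + (f ⊛ (g ∘ suc)) n
    ⊛-unfoldʳ f g zero    = +-comm _ _
    ⊛-unfoldʳ f g (suc n) = begin
      f 0 * g (2 ℕ.+ n) + ((f ∘ suc) ⊛ g) (suc n)
        ≈⟨ +-congˡ (⊛-unfoldʳ (f ∘ suc) g n) ⟩
      f 0 * g (2 ℕ.+ n) + (f (2 ℕ.+ n) * g 0 + ((f ∘ suc) ⊛ (g ∘ suc)) n)
        ≈⟨ solve 3 (λ a b x → a :+ (b :+ x) := b :+ (a :+ x)) refl _ _ _ ⟩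
      f (2 ℕ.+ n) * g 0 + (f 0 * g (2 ℕ.+ n) + ((f ∘ suc) ⊛ (g ∘ suc)) n) ∎

    ⊛-comm : ∀ f g → (f ⊛ g) ≐ (g ⊛ f)
    ⊛-comm f g zero    = *-comm _ _
    ⊛-comm f g (suc n) = begin
      f 0 * g (suc n) + ((f ∘ suc) ⊛ g) n ≈⟨ +-cong (*-comm _ _) (⊛-comm (f ∘ suc) g n) ⟩
      g (suc n) * f 0 + (g ⊛ (f ∘ suc)) n ≈⟨ ⊛-unfoldʳ g f n ⟨
      (g ⊛ f) (suc n)                     ∎

    ⊛-assoc : ∀ f g h → ((f ⊛ g) ⊛ h) ≐ (f ⊛ (g ⊛ h))
    ⊛-assoc f g h zero    = *-assoc _ _ _
    ⊛-assoc f g h (suc n) = begin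
      f 0 * g 0 * h (suc n) + (((λ m → f 0 * g (suc m)) ⊕ ((f ∘ suc) ⊛ g)) ⊛ h) n
        ≈⟨ +-congˡ (⊛-distribʳ h (λ m → f 0 * g (suc m)) ((f ∘ suc) ⊛ g) n) ⟩
      f 0 * g 0 * h (suc n) +
        (((λ m → f 0 * g (suc m)) ⊛ h) n + (((f ∘ suc) ⊛ g) ⊛ h) n)
        ≈⟨ +-congˡ (+-cong (⊛-scale (f 0) (g ∘ suc) h n) (⊛-assoc (f ∘ suc) g h n)) ⟩
      f 0 * g 0 * h (suc n) +
        (f 0 * ((g ∘ suc) ⊛ h) n + ((f ∘ suc) ⊛ (g ⊛ h)) n)
        ≈⟨ solve 5 (λ a b x u v → a :* b :* x :+ (a :* u :+ v) := a :* (b :* x :+ u) :+ v)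
             refl (f 0) (g 0) (h (suc n)) _ _ ⟩
      f 0 * (g 0 * h (suc n) + ((g ∘ suc) ⊛ h) n) + ((f ∘ suc) ⊛ (g ⊛ h)) n ∎

    ⊛-identityˡ : ∀ f → (1≐ ⊛ f) ≐ f
    ⊛-identityˡ f zero    = *-identityˡ _
    ⊛-identityˡ f (suc n) =
      trans (+-cong (*-identityˡ _) (⊛-zeroˡ f n)) (+-identityʳ _)

    seq-isCommutativeRing : IsCommutativeRing _≐_ _⊕_ _⊛_ (-_ ∘_) 0≐ 1≐
    seq-isCommutativeRing = record
      { isRing = record
        { +-isAbelianGroup = Pointwise.isAbelianGroup ℕ +-isAbelianGroup
        ; *-cong           = ⊛-cong
        ; *-assoc          = ⊛-assoc
        ; *-identity       = ⊛-identityˡ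
                           , λ f n → trans (⊛-comm f 1≐ n) (⊛-identityˡ f n)
        ; distrib          = (λ h f g n → trans (⊛-comm h (f ⊕ g) n)
                               (trans (⊛-distribʳ h f g n)
                                 (+-cong (⊛-comm f h n) (⊛-comm g h n))))
                           , ⊛-distribʳ
        }
      ; *-comm = ⊛-comm
      }

  coeff-+ₚ : ∀ p q n → coeff (p +ₚ q) n ≈ coeff p n + coeff q n
  coeff-+ₚ []      q       n       = sym (+-identityˡ _)
  coeff-+ₚ (a ∷ p) []      n       = sym (+-identityʳ _)
  coeff-+ₚ (a ∷ p) (b ∷ q) zero    = refl
  coeff-+ₚ (a ∷ p) (b ∷ q) (suc n) = coeff-+ₚ p q n

  coeff-scale : ∀ a p n → coeff (map (a *_) p) n ≈ a * coeff p n
  coeff-scale a []      n       = sym (zeroʳ a)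
  coeff-scale a (b ∷ p) zero    = refl
  coeff-scale a (b ∷ p) (suc n) = coeff-scale a p n

  private
    coeff-⊛ : ∀ p q n → coeff (p *ₚ q) n ≈ (coeff p ⊛ coeff q) n
    coeff-⊛ []      q n       = sym (⊛-zeroˡ (coeff q) n)
    coeff-⊛ (a ∷ p) q zero    = begin
      coeff (map (a *_) q +ₚ (0# ∷ (p *ₚ q))) 0 ≈⟨ coeff-+ₚ (map (a *_) q) _ 0 ⟩
      coeff (map (a *_) q) 0 + 0#               ≈⟨ +-identityʳ _ ⟩
      coeff (map (a *_) q) 0                    ≈⟨ coeff-scale a q 0 ⟩
      a * coeff q 0                             ∎
    coeff-⊛ (a ∷ p) q (suc n) = begin
      coeff (map (a *_) q +ₚ (0# ∷ (p *ₚ q))) (suc n)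
        ≈⟨ coeff-+ₚ (map (a *_) q) _ (suc n) ⟩
      coeff (map (a *_) q) (suc n) + coeff (p *ₚ q) n
        ≈⟨ +-cong (coeff-scale a q (suc n)) (coeff-⊛ p q n) ⟩
      a * coeff q (suc n) + (coeff p ⊛ coeff q) n ∎

  -ₚ_ : Pol → Pol
  -ₚ_ = map (-_)

  private
    coeff-neg : ∀ p n → coeff (-ₚ p) n ≈ - coeff p n
    coeff-neg []      n       = sym -0#≈0#
    coeff-neg (a ∷ p) zero    = refl
    coeff-neg (a ∷ p) (suc n) = coeff-neg p n

    pol-rawRing seq-rawRing : RawRing c ℓ
    pol-rawRing = record
      { Carrier = Pol ; _≈_ = _≈ₚ_ ; _+_ = _+ₚ_ ; _*_ = _*ₚ_ ; -_ = -ₚ_ ; 0# = [] ; 1# = oneₚ }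
    seq-rawRing = record
      { Carrier = Seq ; _≈_ = _≐_ ; _+_ = _⊕_ ; _*_ = _⊛_ ; -_ = -_ ∘_ ; 0# = 0≐ ; 1# = 1≐ }

    -- Equality of polynomials is by definition equality of coefficient sequences, so injectivity is
    -- immediate and all ring laws transfer.
    coeff-isRingMonomorphism : IsRingMonomorphism pol-rawRing seq-rawRing coeff
    coeff-isRingMonomorphism = record
      { isRingHomomorphism = record
        { isSemiringHomomorphism = record
          { isNearSemiringHomomorphism = record
            { +-isMonoidHomomorphism = record
              { isMagmaHomomorphism = record
                { isRelHomomorphism = record { cong = λ p≈q → p≈q }
                ; homo = coeff-+ₚ
                }
              ; ε-homo = λ _ → refl
              }
            ; *-homo = coeff-⊛
            }
          ; 1#-homo = λ _ → refl
          }
        ; -‿homo = coeff-neg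
        }
      ; injective = λ p≈q → p≈q
      }

  polynomialRing : CommutativeRing c ℓ
  polynomialRing = record
    { isCommutativeRing =
        RingMonomorphism.isCommutativeRing coeff-isRingMonomorphism seq-isCommutativeRing }

  -- A strict upper bound on the degree that admits the zero polynomial. It can be carried along
  -- without knowing which coefficient is the last nonzero one.
  DegLt : Pol → ℕ → Set ℓ
  DegLt p n = ∀ m → n ≤ m → coeff p m ≈ 0#

  private
    -- In each product `f i * g (n - i)` either `i > a`, or `n - i ≥ b`.
    ⊛-vanish : ∀ {f g} a b → (∀ m → a < m → f m ≈ 0#) → (∀ m → b ≤ m → g m ≈ 0#) →
               ∀ n → a ℕ.+ b ≤ n → (f ⊛ g) n ≈ 0#
    ⊛-vanish {f} {g} zero    b F G zero    b≤n = trans (*-congˡ (G 0 b≤n)) (zeroʳ _)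
    ⊛-vanish {f} {g} zero    b F G (suc n) b≤n = begin
      f 0 * g (suc n) + ((f ∘ suc) ⊛ g) n
        ≈⟨ +-cong (*-congˡ (G (suc n) b≤n))
             (⊛-cong {g = g} (λ m → F (suc m) (s≤s z≤n)) (λ _ → refl) n) ⟩
      f 0 * 0# + (0≐ ⊛ g) n ≈⟨ +-cong (zeroʳ _) (⊛-zeroˡ g n) ⟩
      0# + 0#               ≈⟨ +-identityˡ _ ⟩
      0#                    ∎
    ⊛-vanish {f} {g} (suc a) b F G (suc n) (s≤s a+b≤n) = begin
      f 0 * g (suc n) + ((f ∘ suc) ⊛ g) n
        ≈⟨ +-cong (*-congˡ (G (suc n) (ℕ.m≤n⇒m≤1+n (ℕ.m+n≤o⇒n≤o a a+b≤n))))
             (⊛-vanish a b (λ m a<m → F (suc m) (s≤s a<m)) G n a+b≤n) ⟩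
      f 0 * 0# + 0# ≈⟨ trans (+-identityʳ _) (zeroʳ _) ⟩
      0#            ∎

    -- Only the product with `i = a` survives: a larger `i` annihilates `f`, and a smaller one
    -- leaves an index above `b` for `g`.
    ⊛-top : ∀ {f g} a b → (∀ m → a < m → f m ≈ 0#) → (∀ m → b < m → g m ≈ 0#) →
            (f ⊛ g) (a ℕ.+ b) ≈ f a * g b
    ⊛-top {f} {g} zero    zero    F G = refl
    ⊛-top {f} {g} zero    (suc b) F G = begin
      f 0 * g (suc b) + ((f ∘ suc) ⊛ g) b
        ≈⟨ +-congˡ (⊛-cong {g = g} (λ m → F (suc m) (s≤s z≤n)) (λ _ → refl) b) ⟩
      f 0 * g (suc b) + (0≐ ⊛ g) b ≈⟨ +-congˡ (⊛-zeroˡ g b) ⟩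
      f 0 * g (suc b) + 0#         ≈⟨ +-identityʳ _ ⟩
      f 0 * g (suc b)              ∎
    ⊛-top {f} {g} (suc a) b F G = begin
      f 0 * g (suc (a ℕ.+ b)) + ((f ∘ suc) ⊛ g) (a ℕ.+ b)
        ≈⟨ +-cong (*-congˡ (G (suc (a ℕ.+ b)) (s≤s (ℕ.m≤n+m b a))))
             (⊛-top a b (λ m a<m → F (suc m) (s≤s a<m)) G) ⟩
      f 0 * 0# + f (suc a) * g b ≈⟨ trans (+-congʳ (zeroʳ _)) (+-identityˡ _) ⟩
      f (suc a) * g b            ∎

  DegLt-mono : ∀ {p m n} → m ≤ n → DegLt p m → DegLt p n
  DegLt-mono m≤n P k n≤k = P k (ℕ.≤-trans m≤n n≤k)

  DegLt-pred : ∀ p {n} → DegLt p (suc n) → coeff p n ≈ 0# → DegLt p n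
  DegLt-pred p P pₙ≈0 m n≤m with ℕ.m≤n⇒m<n∨m≡n n≤m
  ... | inj₁ n<m    = P m n<m
  ... | inj₂ ≡.refl = pₙ≈0

  DegLt-length : ∀ p → DegLt p (length p)
  DegLt-length []      k       _         = refl
  DegLt-length (a ∷ p) (suc k) (s≤s l≤k) = DegLt-length p k l≤k

  DegLt-const : ∀ a → DegLt (const a) 1
  DegLt-const a (suc k) _ = refl

  DegLt-+ : ∀ p q {n} → DegLt p n → DegLt q n → DegLt (p +ₚ q) n
  DegLt-+ p q P Q k n≤k =
    trans (coeff-+ₚ p q k) (trans (+-cong (P k n≤k) (Q k n≤k)) (+-identityˡ _))

  DegLt-* : ∀ p q {a b} → DegLt p (suc a) → DegLt q b → DegLt (p *ₚ q) (a ℕ.+ b)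
  DegLt-* p q {a} {b} P Q n a+b≤n = trans (coeff-⊛ p q n) (⊛-vanish a b P Q n a+b≤n)

  DegLt-neg : ∀ p {n} → DegLt p n → DegLt (-ₚ p) n
  DegLt-neg p P k n≤k = trans (coeff-neg p k) (trans (-‿cong (P k n≤k)) -0#≈0#)

  coeff-*-top : ∀ p q {a b} → DegLt p (suc a) → DegLt q (suc b) →
                coeff (p *ₚ q) (a ℕ.+ b) ≈ coeff p a * coeff q b
  coeff-*-top p q {a} {b} P Q = trans (coeff-⊛ p q (a ℕ.+ b)) (⊛-top a b P Q)

  coeff-sub : ∀ p q n → coeff (p +ₚ (-ₚ q)) n ≈ coeff p n - coeff q n
  coeff-sub p q n = trans (coeff-+ₚ p (-ₚ q) n) (+-congˡ (coeff-neg q n))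

  coeff-const* : ∀ a p n → coeff (const a *ₚ p) n ≈ a * coeff p n
  coeff-const* a p n = trans (coeff-+ₚ (map (a *_) p) (0# ∷ []) n)
    (trans (+-cong (coeff-scale a p n) (0∷[]≈0 n)) (+-identityʳ _))
    where
    0∷[]≈0 : ∀ n → coeff (0# ∷ []) n ≈ 0#
    0∷[]≈0 zero    = refl
    0∷[]≈0 (suc n) = refl

-- Binary forms over a commutative ring.

module _ {c ℓ} (S : CommutativeRing c ℓ) where
  open CommutativeRing S hiding (zero)
  open RingProperties ring using (-‿distribʳ-*)
  open SetoidReasoning setoid
  open SemiringSolver commutativeSemiring using (solve; _:+_; _:*_; _:=_; con)

  *-difference : ∀ {x y z} → x * y ≈ x * z → x * (y - z) ≈ 0#
  *-difference {x} {y} {z} xy≈xz = begin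
    x * (y - z)       ≈⟨ distribˡ x y (- z) ⟩
    x * y + x * - z   ≈⟨ +-cong xy≈xz (sym (-‿distribʳ-* x z)) ⟩
    x * z - x * z     ≈⟨ -‿inverseʳ (x * z) ⟩
    0#                ∎

  infixr 8 _^_
  _^_ : Carrier → ℕ → Carrier
  x ^ zero  = 1#
  x ^ suc n = x * x ^ n

  -- ∑_{i ≤ m} aᵢ Xⁱ Yᵐ⁻ⁱ in Horner form.
  form : (ℕ → Carrier) → ℕ → Carrier → Carrier → Carrier
  form a zero    X Y = a 0
  form a (suc m) X Y = a 0 * Y ^ suc m + X * form (a ∘ suc) m X Y

  -- Every term other than the pure power of `X` contains a factor `Y`. This is the expansion of the
  -- form at the point at infinity.
  form-split-Y : ∀ a m X Y → form a (suc m) X Y ≈ Y * form a m X Y + a (suc m) * X ^ suc m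
  form-split-Y a zero X Y =
    solve 4 (λ a b X Y → a :* (Y :* con 1) :+ X :* b := Y :* a :+ b :* (X :* con 1))
      refl (a 0) (a 1) X Y
  form-split-Y a (suc m) X Y = begin
    a 0 * Y ^ (2 ℕ.+ m) + X * form (a ∘ suc) (suc m) X Y
      ≈⟨ +-congˡ (*-congˡ (form-split-Y (a ∘ suc) m X Y)) ⟩
    a 0 * (Y * Y ^ suc m) + X * (Y * form (a ∘ suc) m X Y + a (2 ℕ.+ m) * X ^ suc m)
      ≈⟨ solve 7 (λ a Y Z X F b W →
             a :* (Y :* Z) :+ X :* (Y :* F :+ b :* W) := Y :* (a :* Z :+ X :* F) :+ b :* (X :* W))
           refl (a 0) Y (Y ^ suc m) X (form (a ∘ suc) m X Y) (a (2 ℕ.+ m)) (X ^ suc m) ⟩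
    Y * (a 0 * Y ^ suc m + X * form (a ∘ suc) m X Y) + a (2 ℕ.+ m) * (X * X ^ suc m) ∎

  -- Homogeneous synthetic division by `w = X - c Y`: the hypotheses on `q` and `r` are the Horner
  -- recurrences for quotient and remainder, and the last one bounds the degree of the quotient by
  -- `m`.
  form-split-linear : ∀ {c w X Y} → X ≈ w + c * Y → ∀ a q r m →
    a 0 + c * q 0 ≈ r → (∀ i → a (suc i) + c * q (suc i) ≈ q i) → q (suc m) ≈ 0# →
    form a (suc m) X Y ≈ w * form q m X Y + r * Y ^ suc m
  form-split-linear {c} {w} {X} {Y} X≈ a q r zero a0 ai q1≈0 = begin
    a 0 * (Y * 1#) + X * a 1
      ≈⟨ +-congˡ (*-cong X≈ a1≈q0) ⟩
    a 0 * (Y * 1#) + (w + c * Y) * q 0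
      ≈⟨ solve 5 (λ a Y w c q → a :* (Y :* con 1) :+ (w :+ c :* Y) :* q
                               := w :* q :+ (a :+ c :* q) :* (Y :* con 1)) refl (a 0) Y w c (q 0) ⟩
    w * q 0 + (a 0 + c * q 0) * (Y * 1#)
      ≈⟨ +-congˡ (*-congʳ a0) ⟩
    w * q 0 + r * (Y * 1#) ∎
    where
    a1≈q0 : a 1 ≈ q 0
    a1≈q0 = trans (sym (trans (+-congˡ (trans (*-congˡ q1≈0) (zeroʳ c))) (+-identityʳ _))) (ai 0)
  form-split-linear {c} {w} {X} {Y} X≈ a q r (suc m) a0 ai q≈0 = begin
    a 0 * (Y * Z) + X * form (a ∘ suc) (suc m) X Y
      ≈⟨ +-congˡ (*-cong X≈
           (form-split-linear X≈ (a ∘ suc) (q ∘ suc) (q 0) m (ai 0) (ai ∘ suc) q≈0)) ⟩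
    a 0 * (Y * Z) + (w + c * Y) * (w * Q + q 0 * Z)
      ≈⟨ solve 7 (λ a Y Z w c Q q →
             a :* (Y :* Z) :+ (w :+ c :* Y) :* (w :* Q :+ q :* Z)
             := w :* (q :* Z :+ (w :+ c :* Y) :* Q) :+ (a :+ c :* q) :* (Y :* Z))
           refl (a 0) Y Z w c Q (q 0) ⟩
    w * (q 0 * Z + (w + c * Y) * Q) + (a 0 + c * q 0) * (Y * Z)
      ≈⟨ +-cong (*-congˡ (+-congˡ (*-congʳ (sym X≈)))) (*-congʳ a0) ⟩
    w * (q 0 * Z + X * Q) + r * (Y * Z) ∎
    where
    Z = Y ^ suc m
    Q = form (q ∘ suc) m X Y

  -- Follows the recursion of `homogAux`, which adds terms by increasing power of `X`; it serves as
  -- the bridge from there to Horner form.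
  partialForm : (ℕ → Carrier) → ℕ → Carrier → Carrier → ℕ → Carrier
  partialForm a N X Y zero    = a 0 * Y ^ N
  partialForm a N X Y (suc k) =
    partialForm a N X Y k + a (suc k) * X ^ suc k * Y ^ (N ∸ suc k)

  partialForm-suc : ∀ a N X Y k →
    partialForm a (suc N) X Y (suc k) ≈ a 0 * Y ^ suc N + X * partialForm (a ∘ suc) N X Y k
  partialForm-suc a N X Y zero =
    +-congˡ (solve 3 (λ b X Z → b :* (X :* con 1) :* Z := X :* (b :* Z)) refl (a 1) X (Y ^ N))
  partialForm-suc a N X Y (suc k) = begin
    partialForm a (suc N) X Y (suc k) + b * (X * W) * Z
      ≈⟨ +-congʳ (partialForm-suc a N X Y k) ⟩
    a 0 * Y ^ suc N + X * partialForm (a ∘ suc) N X Y k + b * (X * W) * Z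
      ≈⟨ solve 6 (λ e X F b W Z → e :+ X :* F :+ b :* (X :* W) :* Z := e :+ X :* (F :+ b :* W :* Z))
           refl (a 0 * Y ^ suc N) X _ b W Z ⟩
    a 0 * Y ^ suc N + X * (partialForm (a ∘ suc) N X Y k + b * W * Z) ∎
    where
    b = a (2 ℕ.+ k)
    W = X ^ suc k
    Z = Y ^ (N ∸ suc k)

  partialForm≈form : ∀ a N X Y → partialForm a N X Y N ≈ form a N X Y
  partialForm≈form a zero    X Y = *-identityʳ _
  partialForm≈form a (suc N) X Y =
    trans (partialForm-suc a N X Y N) (+-congˡ (*-congˡ (partialForm≈form (a ∘ suc) N X Y)))

  -- Brings a factor shared by `P` and `N` to the front of both sides, ready for cancellation in the
  -- induction of `degree-≤`.
  extract-factor : ∀ {l P P′ Q N N′ D} → P ≈ l * P′ → N ≈ l * N′ → P * D ≈ Q * N →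
                   l * (P′ * D) ≈ l * (Q * N′)
  extract-factor {l} {P} {P′} {Q} {N} {N′} {D} P≈ N≈ PD≈QN = begin
    l * (P′ * D)  ≈⟨ *-assoc l P′ D ⟨
    l * P′ * D    ≈⟨ *-congʳ P≈ ⟨
    P * D         ≈⟨ PD≈QN ⟩
    Q * N         ≈⟨ *-congˡ N≈ ⟩
    Q * (l * N′)  ≈⟨ solve 3 (λ Q l N → Q :* (l :* N) := l :* (Q :* N)) refl Q l N′ ⟩
    l * (Q * N′)  ∎

  sub-add : ∀ x y → x ≈ (x - y) + y
  sub-add x y = begin
    x             ≈⟨ +-identityʳ x ⟨
    x + 0#        ≈⟨ +-congˡ (-‿inverseˡ y) ⟨
    x + (- y + y) ≈⟨ +-assoc x (- y) y ⟨
    x - y + y     ∎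

  zero-product : ∀ {x y} → y ≈ 0# → x * y ≈ 0#
  zero-product {x} y≈0 = trans (*-congˡ y≈0) (zeroʳ x)

  drop-zero-term : ∀ {x y r z} → x ≈ y + r * z → r ≈ 0# → x ≈ y
  drop-zero-term {x} {y} {r} {z} x≈ r≈0 =
    trans x≈ (trans (+-congˡ (trans (*-congʳ r≈0) (zeroˡ z))) (+-identityʳ y))

  drop-zero-multiple : ∀ {x w y v} → x ≈ w * y + v → w ≈ 0# → x ≈ v
  drop-zero-multiple {x} {w} {y} {v} x≈ w≈0 =
    trans x≈ (trans (+-congʳ (trans (*-congʳ w≈0) (zeroˡ y))) (+-identityˡ v))

-- Evaluation of polynomials along a ring homomorphism.

module Evaluation {c₁ ℓ₁ c₂ ℓ₂} (R : CommutativeRing c₁ ℓ₁) (S : CommutativeRing c₂ ℓ₂)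
  (φ : CommutativeRing.Carrier R → CommutativeRing.Carrier S)
  (φ-hom : IsRingHomomorphism (CommutativeRing.rawRing R) (CommutativeRing.rawRing S) φ)
  (y : CommutativeRing.Carrier S) where
  private
    module R = CommutativeRing R
    module φ = IsRingHomomorphism φ-hom
  open CommutativeRing S hiding (zero)
  open Poly R
  open PolynomialRing R
  open SetoidReasoning setoid
  open SemiringSolver commutativeSemiring using (solve; _:+_; _:*_; _:=_)

  evaluate : Pol → Carrier
  evaluate p = Poly.eval S (map φ p) y

  evaluate-zero : ∀ p → IsZero p → evaluate p ≈ 0#
  evaluate-zero []      _  = refl
  evaluate-zero (a ∷ p) p≈0 = begin
    φ a + y * evaluate p
      ≈⟨ +-cong (trans (φ.⟦⟧-cong (p≈0 0)) φ.0#-homo)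
           (*-congˡ (evaluate-zero p (p≈0 ∘ suc))) ⟩
    0# + y * 0# ≈⟨ trans (+-identityˡ _) (zeroʳ y) ⟩
    0#          ∎

  evaluate-cong : ∀ p q → p ≈ₚ q → evaluate p ≈ evaluate q
  evaluate-cong []      q       p≈q = sym (evaluate-zero q (λ n → R.sym (p≈q n)))
  evaluate-cong (a ∷ p) []      p≈q = evaluate-zero (a ∷ p) p≈q
  evaluate-cong (a ∷ p) (b ∷ q) p≈q =
    +-cong (φ.⟦⟧-cong (p≈q 0)) (*-congˡ (evaluate-cong p q (p≈q ∘ suc)))

  evaluate-+ : ∀ p q → evaluate (p +ₚ q) ≈ evaluate p + evaluate q
  evaluate-+ []      q       = sym (+-identityˡ _)
  evaluate-+ (a ∷ p) []      = sym (+-identityʳ _)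
  evaluate-+ (a ∷ p) (b ∷ q) = begin
    φ (a R.+ b) + y * evaluate (p +ₚ q) ≈⟨ +-cong (φ.+-homo a b) (*-congˡ (evaluate-+ p q)) ⟩
    φ a + φ b + y * (evaluate p + evaluate q)
      ≈⟨ solve 5 (λ a b y u v → a :+ b :+ y :* (u :+ v) := (a :+ y :* u) :+ (b :+ y :* v))
           refl (φ a) (φ b) y _ _ ⟩
    (φ a + y * evaluate p) + (φ b + y * evaluate q) ∎

  evaluate-scale : ∀ a p → evaluate (map (a R.*_) p) ≈ φ a * evaluate p
  evaluate-scale a []      = sym (zeroʳ _)
  evaluate-scale a (b ∷ p) = begin
    φ (a R.* b) + y * evaluate (map (a R.*_) p)
      ≈⟨ +-cong (φ.*-homo a b) (*-congˡ (evaluate-scale a p)) ⟩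
    φ a * φ b + y * (φ a * evaluate p)
      ≈⟨ solve 4 (λ a b y u → a :* b :+ y :* (a :* u) := a :* (b :+ y :* u)) refl _ _ _ _ ⟩
    φ a * (φ b + y * evaluate p) ∎

  evaluate-* : ∀ p q → evaluate (p *ₚ q) ≈ evaluate p * evaluate q
  evaluate-* []      q = sym (zeroˡ _)
  evaluate-* (a ∷ p) q = begin
    evaluate (map (a R.*_) q +ₚ (R.0# ∷ (p *ₚ q)))
      ≈⟨ evaluate-+ (map (a R.*_) q) (R.0# ∷ (p *ₚ q)) ⟩
    evaluate (map (a R.*_) q) + (φ R.0# + y * evaluate (p *ₚ q))
      ≈⟨ +-cong (evaluate-scale a q) (+-cong φ.0#-homo (*-congˡ (evaluate-* p q))) ⟩
    φ a * evaluate q + (0# + y * (evaluate p * evaluate q))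
      ≈⟨ +-congˡ (+-identityˡ _) ⟩
    φ a * evaluate q + y * (evaluate p * evaluate q)
      ≈⟨ solve 4 (λ a q y p → a :* q :+ y :* (p :* q) := (a :+ y :* p) :* q) refl _ _ _ _ ⟩
    (φ a + y * evaluate p) * evaluate q ∎

  evaluate-const : ∀ a → evaluate (const a) ≈ φ a
  evaluate-const a = trans (+-congˡ (zeroʳ y)) (+-identityʳ _)

-- Synthetic division by linear polynomials.

module PolynomialDivision {c ℓ} (R : CommutativeRing c ℓ) where
  open CommutativeRing R hiding (zero)
  open Poly R
  open PolynomialRing R
  open RingProperties ring using (-‿distribˡ-*)
  open SetoidReasoning setoid
  private
    module P = CommutativeRing polynomialRing

    +-assoc-cancel : ∀ {a b c} → a + b ≈ c → a ≈ c - b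
    +-assoc-cancel {a} {b} {c} a+b≈c = begin
      a             ≈⟨ +-identityʳ a ⟨
      a + 0#        ≈⟨ +-congˡ (-‿inverseʳ b) ⟨
      a + (b - b)   ≈⟨ +-assoc a b (- b) ⟨
      a + b - b     ≈⟨ +-congʳ a+b≈c ⟩
      c - b         ∎

  module _ (y : Carrier) where
    private
      module E = Evaluation R R id (Identity.isRingHomomorphism rawRing refl) y

      -- Evaluation along the identity is applied to `map id p`, which equals `p` only
      -- propositionally; hence the rewrites below.
      map-id-≡ : ∀ p → E.evaluate p ≡ eval p y
      map-id-≡ p = ≡.cong (λ q → eval q y) (map-id p)

    eval-cong : ∀ p q → p ≈ₚ q → eval p y ≈ eval q y
    eval-cong p q rewrite ≡.sym (map-id-≡ p) | ≡.sym (map-id-≡ q) = E.evaluate-cong p q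

    eval-zero : ∀ p → IsZero p → eval p y ≈ 0#
    eval-zero p rewrite ≡.sym (map-id-≡ p) = E.evaluate-zero p

    eval-+ : ∀ p q → eval (p +ₚ q) y ≈ eval p y + eval q y
    eval-+ p q rewrite ≡.sym (map-id-≡ p) | ≡.sym (map-id-≡ q) | ≡.sym (map-id-≡ (p +ₚ q)) =
      E.evaluate-+ p q

    eval-* : ∀ p q → eval (p *ₚ q) y ≈ eval p y * eval q y
    eval-* p q rewrite ≡.sym (map-id-≡ p) | ≡.sym (map-id-≡ q) | ≡.sym (map-id-≡ (p *ₚ q)) =
      E.evaluate-* p q

    eval-const : ∀ a → eval (const a) y ≈ a
    eval-const a = E.evaluate-const a

  linear : Carrier → Pol
  linear y = - y ∷ 1# ∷ []

  -- The quotient of synthetic division by x − y.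
  quo : Pol → Carrier → Pol
  quo []      y = []
  quo (a ∷ p) y = eval p y ∷ quo p y

  -- Together with `quo-tail` these are the Horner recurrences, in the shape that
  -- `form-split-linear` asks for.
  quo-head : ∀ p y → coeff p 0 + y * coeff (quo p y) 0 ≈ eval p y
  quo-head []      y = trans (+-identityˡ _) (zeroʳ y)
  quo-head (a ∷ p) y = refl

  quo-tail : ∀ p y n → coeff p (suc n) + y * coeff (quo p y) (suc n) ≈ coeff (quo p y) n
  quo-tail []      y n       = trans (+-identityˡ _) (zeroʳ y)
  quo-tail (a ∷ p) y zero    = quo-head p y
  quo-tail (a ∷ p) y (suc n) = quo-tail p y n

  quo-DegLt : ∀ p y {n} → DegLt p (suc n) → DegLt (quo p y) n
  quo-DegLt []      y         P k       _         = refl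
  -- Here the bound on the quotient is zero, so `p`, the tail of the list, is the zero polynomial
  -- and its value, the first entry of the quotient, vanishes.
  quo-DegLt (a ∷ p) y         P zero    z≤n       = eval-zero y p (λ n → P (suc n) (s≤s z≤n))
  quo-DegLt (a ∷ p) y {zero}  P (suc k) _         =
    quo-DegLt p y {zero} (λ m _ → P (suc m) (s≤s z≤n)) k z≤n
  quo-DegLt (a ∷ p) y {suc n} P (suc k) (s≤s n≤k) =
    quo-DegLt p y (λ m n<m → P (suc m) (s≤s n<m)) k n≤k

  linear-*-head : ∀ y q → coeff (linear y *ₚ q) 0 ≈ - (y * coeff q 0)
  linear-*-head y q = begin
    coeff (linear y *ₚ q) 0         ≈⟨ coeff-+ₚ (map (- y *_) q) (0# ∷ (oneₚ *ₚ q)) 0 ⟩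
    coeff (map (- y *_) q) 0 + 0#   ≈⟨ +-identityʳ _ ⟩
    coeff (map (- y *_) q) 0        ≈⟨ coeff-scale (- y) q 0 ⟩
    - y * coeff q 0                 ≈⟨ -‿distribˡ-* y _ ⟨
    - (y * coeff q 0)               ∎

  linear-*-tail : ∀ y q n → coeff (linear y *ₚ q) (suc n) ≈ coeff q n - y * coeff q (suc n)
  linear-*-tail y q n = begin
    coeff (linear y *ₚ q) (suc n)
      ≈⟨ coeff-+ₚ (map (- y *_) q) (0# ∷ (oneₚ *ₚ q)) (suc n) ⟩
    coeff (map (- y *_) q) (suc n) + coeff (oneₚ *ₚ q) n
      ≈⟨ +-cong (coeff-scale (- y) q (suc n)) (P.*-identityˡ q n) ⟩
    - y * coeff q (suc n) + coeff q n
      ≈⟨ +-comm _ _ ⟩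
    coeff q n + - y * coeff q (suc n)
      ≈⟨ +-congˡ (-‿distribˡ-* y _) ⟨
    coeff q n - y * coeff q (suc n) ∎

  factor : ∀ p y → p ≈ₚ ((linear y *ₚ quo p y) +ₚ const (eval p y))
  factor p y zero = begin
    coeff p 0                                  ≈⟨ +-assoc-cancel (quo-head p y) ⟩
    eval p y - y * coeff (quo p y) 0           ≈⟨ +-comm _ _ ⟩
    - (y * coeff (quo p y) 0) + eval p y       ≈⟨ +-congʳ (linear-*-head y (quo p y)) ⟨
    coeff (linear y *ₚ quo p y) 0 + eval p y   ≈⟨ coeff-+ₚ (linear y *ₚ quo p y) _ 0 ⟨
    coeff ((linear y *ₚ quo p y) +ₚ const (eval p y)) 0 ∎
  factor p y (suc n) = begin
    coeff p (suc n)                                   ≈⟨ +-assoc-cancel (quo-tail p y n) ⟩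
    coeff (quo p y) n - y * coeff (quo p y) (suc n)   ≈⟨ linear-*-tail y (quo p y) n ⟨
    coeff (linear y *ₚ quo p y) (suc n)               ≈⟨ +-identityʳ _ ⟨
    coeff (linear y *ₚ quo p y) (suc n) + 0#          ≈⟨ coeff-+ₚ (linear y *ₚ quo p y) _ (suc n) ⟨
    coeff ((linear y *ₚ quo p y) +ₚ const (eval p y)) (suc n) ∎

  root⇒factor : ∀ p y → eval p y ≈ 0# → p ≈ₚ (linear y *ₚ quo p y)
  root⇒factor p y p[y]≈0 n = begin
    coeff p n                                                  ≈⟨ factor p y n ⟩
    coeff ((linear y *ₚ quo p y) +ₚ const (eval p y)) n         ≈⟨ coeff-+ₚ (linear y *ₚ quo p y) _ n ⟩
    coeff (linear y *ₚ quo p y) n + coeff (const (eval p y)) n  ≈⟨ +-congˡ (const≈0 n) ⟩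
    coeff (linear y *ₚ quo p y) n + 0#                          ≈⟨ +-identityʳ _ ⟩
    coeff (linear y *ₚ quo p y) n                               ∎
    where
    const≈0 : IsZero (const (eval p y))
    const≈0 zero    = p[y]≈0
    const≈0 (suc n) = refl

  -- Since `linear y` is monic, this holds over any commutative ring: the coefficients of `q` vanish
  -- one after another from the top down, starting at the length of the list.
  linear-*-zero : ∀ y q → IsZero (linear y *ₚ q) → IsZero q
  linear-*-zero y q q≈0 n = descend (length q) (DegLt-length q) n z≤n
    where
    descend : ∀ n → DegLt q n → DegLt q 0
    descend zero    Q = Q
    descend (suc n) Q = descend n (DegLt-pred q Q (begin
      coeff q n                                              ≈⟨ +-assoc-cancel refl ⟩
      coeff q n + y * coeff q (suc n) - y * coeff q (suc n)
        ≈⟨ +-congʳ (+-congˡ (*-congˡ (Q (suc n) ℕ.≤-refl))) ⟩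
      coeff q n + y * 0# - y * coeff q (suc n)
        ≈⟨ +-congʳ (trans (+-congˡ (zeroʳ y)) (+-identityʳ _)) ⟩
      coeff q n - y * coeff q (suc n)                        ≈⟨ linear-*-tail y q n ⟨
      coeff (linear y *ₚ q) (suc n)                          ≈⟨ q≈0 (suc n) ⟩
      0#                                                     ∎))

  linear-*-cancel : ∀ y p q → (linear y *ₚ p) ≈ₚ (linear y *ₚ q) → p ≈ₚ q
  linear-*-cancel y p q lp≈lq n = begin
    coeff p n                       ≈⟨ +-assoc-cancel refl ⟩
    coeff p n + coeff q n - coeff q n ≈⟨ trans (+-assoc _ _ _) (trans (+-congˡ (+-comm _ _)) (sym (+-assoc _ _ _))) ⟩
    coeff p n - coeff q n + coeff q n ≈⟨ +-congʳ (sym (coeff-sub p q n)) ⟩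
    coeff (p +ₚ (-ₚ q)) n + coeff q n
      ≈⟨ +-congʳ (linear-*-zero y (p +ₚ (-ₚ q)) difference-zero n) ⟩
    0# + coeff q n                  ≈⟨ +-identityˡ _ ⟩
    coeff q n                       ∎
    where
    difference-zero : IsZero (linear y *ₚ (p +ₚ (-ₚ q)))
    difference-zero =
      *-difference polynomialRing {linear y} {p} {q} lp≈lq

-- Degrees and roots over a field.

module FieldPolynomials {c ℓ} (F : Field c ℓ) where
  open Field F hiding (zero)
  open Poly commutativeRing
  open PolynomialRing commutativeRing
  open PolynomialDivision commutativeRing
  open SetoidReasoning setoid

  *-cancel-0 : ∀ {x y} → ¬ x ≈ 0# → x * y ≈ 0# → y ≈ 0#
  *-cancel-0 {x} {y} x≉0 xy≈0 with x⁻¹ , xx⁻¹≈1 ← inverse x x≉0 = begin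
    y               ≈⟨ *-identityˡ y ⟨
    1# * y          ≈⟨ *-congʳ xx⁻¹≈1 ⟨
    x * x⁻¹ * y     ≈⟨ *-congʳ (*-comm x x⁻¹) ⟩
    x⁻¹ * x * y     ≈⟨ *-assoc x⁻¹ x y ⟩
    x⁻¹ * (x * y)   ≈⟨ zero-product commutativeRing xy≈0 ⟩
    0#              ∎

  *-nonzero : ∀ {x y} → ¬ x ≈ 0# → ¬ y ≈ 0# → ¬ x * y ≈ 0#
  *-nonzero x≉0 y≉0 xy≈0 = y≉0 (*-cancel-0 x≉0 xy≈0)

  division : ∀ x {y} → ¬ y ≈ 0# → ∃ λ z → x ≈ z * y
  division x {y} y≉0 with y⁻¹ , yy⁻¹≈1 ← inverse y y≉0 = x * y⁻¹ , (begin
    x              ≈⟨ *-identityʳ x ⟨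
    x * 1#         ≈⟨ *-congˡ yy⁻¹≈1 ⟨
    x * (y * y⁻¹)  ≈⟨ *-congˡ (*-comm y y⁻¹) ⟩
    x * (y⁻¹ * y)  ≈⟨ *-assoc x y⁻¹ y ⟨
    x * y⁻¹ * y    ∎)

  sub-zero : ∀ {x y} → x ≈ y → x - y ≈ 0#
  sub-zero {x} {y} x≈y = trans (+-congʳ x≈y) (-‿inverseʳ y)

  HasDeg-resp : ∀ {p q n} → p ≈ₚ q → HasDeg p n → HasDeg q n
  HasDeg-resp {n = n} p≈q (pₙ≉0 , p<) =
    (λ qₙ≈0 → pₙ≉0 (trans (p≈q n) qₙ≈0)) , λ m n<m → trans (sym (p≈q m)) (p< m n<m)

  HasDeg⇒nonzero : ∀ {p n} → HasDeg p n → ¬ IsZero p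
  HasDeg⇒nonzero {n = n} (pₙ≉0 , _) p≈0 = pₙ≉0 (p≈0 n)

  HasDeg-const : ∀ {a} → ¬ a ≈ 0# → HasDeg (const a) 0
  HasDeg-const {a} a≉0 = a≉0 , DegLt-const a

  HasDeg-* : ∀ p q {m n} → HasDeg p m → HasDeg q n → HasDeg (p *ₚ q) (m ℕ.+ n)
  HasDeg-* p q {m} {n} (pₘ≉0 , p<) (qₙ≉0 , q<) =
    (λ top≈0 → *-nonzero pₘ≉0 qₙ≉0 (trans (sym (coeff-*-top p q p< q<)) top≈0)) ,
    ≡.subst (DegLt (p *ₚ q)) (ℕ.+-suc m n) (DegLt-* p q p< q<)

  HasDeg-^ : ∀ p {k} → HasDeg p k → ∀ n → HasDeg (_^_ polynomialRing p n) (n ℕ.* k)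
  HasDeg-^ p P zero    = HasDeg-const 1≉0
  HasDeg-^ p P (suc n) = HasDeg-* p (_^_ polynomialRing p n) P (HasDeg-^ p P n)

  HasDeg-+ʳ : ∀ p q {n} → DegLt p n → HasDeg q n → HasDeg (p +ₚ q) n
  HasDeg-+ʳ p q {n} P (qₙ≉0 , q<) =
    (λ sum≈0 → qₙ≉0 (trans (sym (trans (coeff-+ₚ p q n)
      (trans (+-congʳ (P n ℕ.≤-refl)) (+-identityˡ _)))) sum≈0)) ,
    DegLt-+ p q (DegLt-mono {p} (ℕ.n≤1+n n) P) q<

  HasDeg-unique : ∀ p {m n} → HasDeg p m → HasDeg p n → m ≡ n
  HasDeg-unique p {m} {n} (pₘ≉0 , p<m) (pₙ≉0 , p<n) with ℕ.<-cmp m n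
  ... | tri< m<n _ _ = contradiction (p<m n m<n) pₙ≉0
  ... | tri≈ _ m≡n _ = m≡n
  ... | tri> _ _ n<m = contradiction (p<n m n<m) pₘ≉0

  -- Coefficients are tested for zero from the top by excluded middle, so the degree is obtained
  -- only under a double negation.
  degree-exists : ∀ p n → DegLt p n → ¬ IsZero p → ¬ ¬ ∃ λ d → d < n × HasDeg p d
  degree-exists p zero    P p≉0 _    = p≉0 (λ m → P m z≤n)
  degree-exists p (suc n) P p≉0 none = ¬¬-excluded-middle λ where
    (yes pₙ≈0) → degree-exists p n (DegLt-pred p P pₙ≈0) p≉0
                   λ (d , d<n , D) → none (d , ℕ.m≤n⇒m≤1+n d<n , D)
    (no pₙ≉0)  → none (n , ℕ.≤-refl , pₙ≉0 , P)

  NoCommonRoot : Pol → Pol → Set (c Level.⊔ ℓ)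
  NoCommonRoot p q = ∀ y → eval p y ≈ 0# → ¬ eval q y ≈ 0#

  -- A common root `y` would make `linear y` a common divisor, but its coefficient of index 1 is
  -- `1#`, so its degree is not 0.
  coprime⇒noCommonRoot : ∀ p q → Coprime p q → NoCommonRoot p q
  coprime⇒noCommonRoot p q coprime y p[y]≈0 q[y]≈0 =
    1≉0 (proj₂ (coprime (linear y) (divides p p[y]≈0) (divides q q[y]≈0)) 1 ℕ.≤-refl)
    where
    divides : ∀ r → eval r y ≈ 0# → linear y ∣ₚ r
    divides r r[y]≈0 = quo r y , λ n → sym (root⇒factor r y r[y]≈0 n)

  -- The quotient inherits the leading coefficient: in `quo-tail` at the top index the term with
  -- factor `y` vanishes.
  HasDeg-quo : ∀ p y {n} → HasDeg p (suc n) → HasDeg (quo p y) n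
  HasDeg-quo p y {n} (p≉0 , p<) = (λ q≈0 → p≉0 (begin
    coeff p (suc n) ≈⟨ +-identityʳ _ ⟨
    coeff p (suc n) + 0#
      ≈⟨ +-congˡ (zero-product commutativeRing (quo-DegLt p y p< (suc n) ℕ.≤-refl)) ⟨
    coeff p (suc n) + y * coeff (quo p y) (suc n) ≈⟨ quo-tail p y n ⟩
    coeff (quo p y) n ≈⟨ q≈0 ⟩
    0# ∎)) , quo-DegLt p y p<

  degree-zero-rootless : ∀ p y → HasDeg p 0 → ¬ eval p y ≈ 0#
  degree-zero-rootless []      y (p₀≉0 , _)  _      = p₀≉0 refl
  degree-zero-rootless (a ∷ p) y (a≉0 , p<) p[y]≈0 = a≉0 (begin
    a                ≈⟨ +-identityʳ a ⟨
    a + 0#           ≈⟨ +-congˡ (zero-product commutativeRing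
                          (eval-zero y p (λ n → p< (suc n) (s≤s z≤n)))) ⟨
    a + y * eval p y ≈⟨ p[y]≈0 ⟩
    0#               ∎)

  -- Each root of P is a root of N, so linear factors can be removed one at a time.
  degree-≤ : (∀ p n → HasDeg p n → 1 ≤ n → ∃ λ y → eval p y ≈ 0#) →
             ∀ P Q N D m n → HasDeg P m → HasDeg N n → NoCommonRoot P Q →
             (P *ₚ D) ≈ₚ (Q *ₚ N) → m ≤ n
  degree-≤ closed P Q N D zero    n P° N° noRoot PD≈QN = z≤n
  degree-≤ closed P Q N D (suc m) n P° N° noRoot PD≈QN
    with y , P[y]≈0 ← closed P (suc m) P° (s≤s z≤n) = go n N°
    where
    N[y]≈0 : eval N y ≈ 0#
    N[y]≈0 = *-cancel-0 (noRoot y P[y]≈0) (begin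
      eval Q y * eval N y ≈⟨ eval-* y Q N ⟨
      eval (Q *ₚ N) y     ≈⟨ eval-cong y (P *ₚ D) (Q *ₚ N) PD≈QN ⟨
      eval (P *ₚ D) y     ≈⟨ eval-* y P D ⟩
      eval P y * eval D y ≈⟨ *-congʳ P[y]≈0 ⟩
      0# * eval D y       ≈⟨ zeroˡ _ ⟩
      0#                  ∎)
    P≈ = root⇒factor P y P[y]≈0
    noRoot′ : NoCommonRoot (quo P y) Q
    noRoot′ x P′[x]≈0 = noRoot x (begin
      eval P x                             ≈⟨ eval-cong x P (linear y *ₚ quo P y) P≈ ⟩
      eval (linear y *ₚ quo P y) x         ≈⟨ eval-* x (linear y) (quo P y) ⟩
      eval (linear y) x * eval (quo P y) x ≈⟨ zero-product commutativeRing P′[x]≈0 ⟩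
      0#                                   ∎)
    go : ∀ n → HasDeg N n → suc m ≤ n
    go zero    N° = contradiction N[y]≈0 (degree-zero-rootless N y N°)
    -- Cancelling `linear y` turns the relation into the same one between the quotients of `P` and
    -- `N`, with `Q` and `D` unchanged.
    go (suc n) N° = s≤s (degree-≤ closed (quo P y) Q (quo N y) D m n
      (HasDeg-quo P y P°) (HasDeg-quo N y N°) noRoot′
      (linear-*-cancel y (quo P y *ₚ D) (Q *ₚ quo N y)
        (extract-factor polynomialRing {linear y} {P} {quo P y} {Q} {N} {quo N y} {D}
          P≈ (root⇒factor N y N[y]≈0) PD≈QN)))

-- Substituting a fraction into a form: lowest terms and degrees.

module Composition {c ℓ} (F : Field c ℓ) where
  open Field F hiding (zero)
  open Poly commutativeRing
  open PolynomialRing commutativeRing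
  open PolynomialDivision commutativeRing
  open FieldPolynomials F
  open SetoidReasoning setoid
  private module P = CommutativeRing polynomialRing

  infixr 8 _^ᵖ_
  _^ᵖ_ : Pol → ℕ → Pol
  _^ᵖ_ = _^_ polynomialRing

  -- `m` may exceed the degree of `g`; the missing degree counts as a zero of the form at infinity.
  compose : Pol → ℕ → Pol → Pol → Pol
  compose g m X Y = form polynomialRing (const ∘ coeff g) m X Y

  ^ₚ≡^ᵖ : ∀ p n → p ^ₚ n ≡ p ^ᵖ n
  ^ₚ≡^ᵖ p zero    = ≡.refl
  ^ₚ≡^ᵖ p (suc n) = ≡.cong (p *ₚ_) (^ₚ≡^ᵖ p n)

  homog≈compose : ∀ g m X Y → homog g m X Y ≈ₚ compose g m X Y
  homog≈compose g m X Y = ≡.subst (_≈ₚ compose g m X Y) (≡.sym (homogAux≡ m))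
    (partialForm≈form polynomialRing (const ∘ coeff g) m X Y)
    where
    homogAux≡ : ∀ k → homogAux g m X Y k ≡ partialForm polynomialRing (const ∘ coeff g) m X Y k
    homogAux≡ zero    = ≡.cong (const (coeff g 0) *ₚ_) (^ₚ≡^ᵖ Y m)
    homogAux≡ (suc k) = ≡.cong₂ _+ₚ_ (homogAux≡ k)
      (≡.cong₂ (λ p q → (const (coeff g (suc k)) *ₚ p) *ₚ q)
        (^ₚ≡^ᵖ X (suc k)) (^ₚ≡^ᵖ Y (m ∸ suc k)))

  data Point : Set c where
    ∞   : Point
    fin : Carrier → Point

  -- Linear forms in X, Y: `vanishing` vanishes at the point [X : Y] = x and `nonvanishing` does not.
  vanishing nonvanishing : Point → Pol → Pol → Pol
  vanishing ∞       X Y = Y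
  vanishing (fin x) X Y = X +ₚ (-ₚ (const x *ₚ Y))
  nonvanishing ∞       X Y = X
  nonvanishing (fin x) X Y = Y

  -- The value of the form of degree `m` attached to `g`, with `∞` represented by `[1 : 0]` and
  -- `fin x` by `[x : 1]`.
  valueAt : Point → Pol → ℕ → Carrier
  valueAt ∞       g m = coeff g m
  valueAt (fin x) g m = eval g x

  -- At `∞` the linear form to divide by is `Y`; removing it lowers the degree of the form but
  -- leaves the coefficients in place.
  quotientAt : Point → Pol → Pol
  quotientAt ∞       g = g
  quotientAt (fin x) g = quo g x

  const-+* : ∀ {a b x y} → a + x * b ≈ y → (const a +ₚ (const x *ₚ const b)) ≈ₚ const y
  const-+* {a} {b} {x} eq zero    = trans (+-congˡ (+-identityʳ _)) eq
  const-+* {a} {b} {x} eq (suc n) = trans (coeff-const* x (const b) (suc n)) (zeroʳ x)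

  const-zero : ∀ {a} → a ≈ 0# → IsZero (const a)
  const-zero a≈0 zero    = a≈0
  const-zero a≈0 (suc n) = refl

  -- At `∞` the pure power of `X` is set apart; at a finite point this is homogeneous synthetic
  -- division. The common shape lets the later arguments treat all points alike.
  compose-split : ∀ x g m X Y → DegLt g (2 ℕ.+ m) →
    compose g (suc m) X Y ≈ₚ
      ((vanishing x X Y *ₚ compose (quotientAt x g) m X Y) +ₚ
       (const (valueAt x g (suc m)) *ₚ (nonvanishing x X Y ^ᵖ suc m)))
  compose-split ∞       g m X Y g< = form-split-Y polynomialRing (const ∘ coeff g) m X Y
  compose-split (fin x) g m X Y g< =
    form-split-linear polynomialRing {const x} {vanishing (fin x) X Y} {X} {Y}
      (sub-add polynomialRing X (const x *ₚ Y))
      (const ∘ coeff g) (const ∘ coeff (quo g x)) (const (eval g x)) m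
      (const-+* (quo-head g x)) (λ i → const-+* (quo-tail g x i))
      (const-zero (quo-DegLt g x g< (suc m) ℕ.≤-refl))

  quotientAt-DegLt : ∀ x g {m} → DegLt g (2 ℕ.+ m) → valueAt x g (suc m) ≈ 0# →
                     DegLt (quotientAt x g) (suc m)
  quotientAt-DegLt ∞       g g< value≈0 = DegLt-pred g g< value≈0
  quotientAt-DegLt (fin x) g g< value≈0 = quo-DegLt g x g<

  quotientAt-zero : ∀ x g {m} → valueAt x g m ≈ 0# → IsZero (quotientAt x g) → IsZero g
  quotientAt-zero ∞       g value≈0 g≈0 = g≈0
  quotientAt-zero (fin x) g value≈0 q≈0 n =
    trans (root⇒factor g x value≈0 n) (zero-product polynomialRing {linear x} {quo g x} q≈0 n)

  -- At `∞` one of the two values is a leading coefficient, because the maximum is attained; at a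
  -- finite point a common zero would be a common root.
  valueAt-coprime : ∀ g₁ g₂ {a b} → Coprime g₁ g₂ → HasDeg g₁ a → HasDeg g₂ b →
    ∀ x → valueAt x g₁ (a ℕ.⊔ b) ≈ 0# → ¬ valueAt x g₂ (a ℕ.⊔ b) ≈ 0#
  valueAt-coprime g₁ g₂ {a} {b} coprime (g₁≉0 , _) (g₂≉0 , _) ∞ g₁≈0 g₂≈0 with ℕ.⊔-sel a b
  ... | inj₁ a⊔b≡a rewrite a⊔b≡a = g₁≉0 g₁≈0
  ... | inj₂ a⊔b≡b rewrite a⊔b≡b = g₂≉0 g₂≈0
  valueAt-coprime g₁ g₂ coprime _ _ (fin x) = coprime⇒noCommonRoot g₁ g₂ coprime x

  eval-^-nonzero : ∀ p y n → ¬ eval p y ≈ 0# → ¬ eval (p ^ᵖ n) y ≈ 0#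
  eval-^-nonzero p y zero    p≉0 1≈0 = 1≉0 (trans (sym (eval-const y 1#)) 1≈0)
  eval-^-nonzero p y (suc n) p≉0 pp≈0 =
    *-nonzero p≉0 (eval-^-nonzero p y n p≉0) (trans (sym (eval-* y p (p ^ᵖ n))) pp≈0)

  -- Evaluating `compose-split` at `y` leaves only the remainder times a power of the nonvanishing
  -- linear form, which is nonzero there.
  compose-root : ∀ x g m X Y y → DegLt g (2 ℕ.+ m) →
    eval (vanishing x X Y) y ≈ 0# → ¬ eval (nonvanishing x X Y) y ≈ 0# →
    eval (compose g (suc m) X Y) y ≈ 0# → valueAt x g (suc m) ≈ 0#
  compose-root x g m X Y y g< w≈0 z≉0 C≈0 =
    *-cancel-0 (eval-^-nonzero z y (suc m) z≉0) (trans (*-comm _ r) (begin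
      r * eval (z ^ᵖ suc m) y
        ≈⟨ *-congʳ (eval-const y r) ⟨
      eval (const r) y * eval (z ^ᵖ suc m) y
        ≈⟨ eval-* y (const r) (z ^ᵖ suc m) ⟨
      eval (const r *ₚ (z ^ᵖ suc m)) y
        ≈⟨ drop-zero-multiple commutativeRing evaluated w≈0 ⟨
      eval (compose g (suc m) X Y) y
        ≈⟨ C≈0 ⟩
      0# ∎))
    where
    w = vanishing x X Y
    z = nonvanishing x X Y
    r = valueAt x g (suc m)
    C′ = compose (quotientAt x g) m X Y
    evaluated : eval (compose g (suc m) X Y) y ≈
                eval w y * eval C′ y + eval (const r *ₚ (z ^ᵖ suc m)) y
    evaluated = begin
      eval (compose g (suc m) X Y) y
        ≈⟨ eval-cong y (compose g (suc m) X Y) ((w *ₚ C′) +ₚ (const r *ₚ (z ^ᵖ suc m)))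
             (compose-split x g m X Y g<) ⟩
      eval ((w *ₚ C′) +ₚ (const r *ₚ (z ^ᵖ suc m))) y
        ≈⟨ eval-+ y (w *ₚ C′) (const r *ₚ (z ^ᵖ suc m)) ⟩
      eval (w *ₚ C′) y + eval (const r *ₚ (z ^ᵖ suc m)) y
        ≈⟨ +-congʳ (eval-* y w C′) ⟩
      eval w y * eval C′ y + eval (const r *ₚ (z ^ᵖ suc m)) y ∎

  module _ (g₁ g₂ : Pol) {a b} (g-coprime : Coprime g₁ g₂) (G₁ : HasDeg g₁ a) (G₂ : HasDeg g₂ b) where

    HasDeg⇒DegLt-⊔ : DegLt g₁ (suc (a ℕ.⊔ b)) × DegLt g₂ (suc (a ℕ.⊔ b))
    HasDeg⇒DegLt-⊔ = DegLt-mono {g₁} (s≤s (ℕ.m≤m⊔n a b)) (proj₂ G₁)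
                   , DegLt-mono {g₂} (s≤s (ℕ.m≤n⊔m a b)) (proj₂ G₂)

    compose-noCommonRoot : ∀ X Y {m} → a ℕ.⊔ b ≡ suc m → NoCommonRoot X Y →
      NoCommonRoot (compose g₁ (suc m) X Y) (compose g₂ (suc m) X Y)
    compose-noCommonRoot X Y {m} a⊔b≡ noRoot y C₁≈0 C₂≈0 = ¬¬-excluded-middle λ where
        -- The point is `[X(y) : Y(y)]`: infinity when `Y(y)` vanishes, otherwise the finite point
        -- `X(y) / Y(y)`.
        (yes Y≈0) → at ∞ Y≈0 (λ X≈0 → noRoot y X≈0 Y≈0)
        (no Y≉0)  → let x , X≈xY = division (eval X y) Y≉0 in at (fin x) (vanishes x X≈xY) Y≉0
      where
      split : ∀ x → eval X y ≈ eval (X +ₚ (-ₚ (const x *ₚ Y))) y + x * eval Y y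
      split x = begin
        eval X y
          ≈⟨ eval-cong y X ((X +ₚ (-ₚ (const x *ₚ Y))) +ₚ (const x *ₚ Y))
               (sub-add polynomialRing X (const x *ₚ Y)) ⟩
        eval ((X +ₚ (-ₚ (const x *ₚ Y))) +ₚ (const x *ₚ Y)) y
          ≈⟨ eval-+ y (X +ₚ (-ₚ (const x *ₚ Y))) (const x *ₚ Y) ⟩
        eval (X +ₚ (-ₚ (const x *ₚ Y))) y + eval (const x *ₚ Y) y
          ≈⟨ +-congˡ (trans (eval-* y (const x) Y) (*-congʳ (eval-const y x))) ⟩
        eval (X +ₚ (-ₚ (const x *ₚ Y))) y + x * eval Y y ∎
      vanishes : ∀ x → eval X y ≈ x * eval Y y → eval (vanishing (fin x) X Y) y ≈ 0#
      vanishes x X≈xY = begin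
        w[y]                              ≈⟨ +-identityʳ _ ⟨
        w[y] + 0#                         ≈⟨ +-congˡ (-‿inverseʳ (x * eval Y y)) ⟨
        w[y] + (x * eval Y y - x * eval Y y) ≈⟨ +-assoc _ _ _ ⟨
        w[y] + x * eval Y y - x * eval Y y ≈⟨ +-congʳ (split x) ⟨
        eval X y - x * eval Y y           ≈⟨ sub-zero X≈xY ⟩
        0#                                ∎
        where w[y] = eval (vanishing (fin x) X Y) y
      at : ∀ x → eval (vanishing x X Y) y ≈ 0# → ¬ eval (nonvanishing x X Y) y ≈ 0# → ⊥
      at x w≈0 z≉0 = valueAt-coprime g₁ g₂ g-coprime G₁ G₂ x
        (≡.subst (λ n → valueAt x g₁ n ≈ 0#) (≡.sym a⊔b≡)
          (compose-root x g₁ m X Y y (≡.subst (DegLt g₁ ∘ suc) a⊔b≡ (proj₁ HasDeg⇒DegLt-⊔))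
            w≈0 z≉0 C₁≈0))
        (≡.subst (λ n → valueAt x g₂ n ≈ 0#) (≡.sym a⊔b≡)
          (compose-root x g₂ m X Y y (≡.subst (DegLt g₂ ∘ suc) a⊔b≡ (proj₂ HasDeg⇒DegLt-⊔))
            w≈0 z≉0 C₂≈0))

  compose-DegLt : ∀ X Y {k} → DegLt X (suc k) → DegLt Y (suc k) →
                  ∀ g m → DegLt (compose g m X Y) (suc (m ℕ.* k))
  compose-DegLt X Y {k} X< Y< g m = form-DegLt (coeff g) m
    where
    power-DegLt : ∀ m → DegLt (Y ^ᵖ m) (suc (m ℕ.* k))
    power-DegLt zero    = DegLt-const 1#
    power-DegLt (suc m) = ≡.subst (DegLt (Y ^ᵖ suc m)) (ℕ.+-suc k (m ℕ.* k))
      (DegLt-* Y (Y ^ᵖ m) Y< (power-DegLt m))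
    form-DegLt : ∀ a m → DegLt (form polynomialRing (const ∘ a) m X Y) (suc (m ℕ.* k))
    form-DegLt a zero    = DegLt-const (a 0)
    form-DegLt a (suc m) = DegLt-+ (const (a 0) *ₚ (Y ^ᵖ suc m)) (X *ₚ rest)
      (DegLt-* (const (a 0)) (Y ^ᵖ suc m) (DegLt-const (a 0)) (power-DegLt (suc m)))
      (≡.subst (DegLt (X *ₚ rest)) (ℕ.+-suc k (m ℕ.* k)) (DegLt-* X rest X< (form-DegLt (a ∘ suc) m)))
      where rest = form polynomialRing (const ∘ a ∘ suc) m X Y

  -- u is the order of vanishing at x of the degree-m form associated with g.
  compose-degree : ∀ x X Y {k t} → DegLt X (suc k) → DegLt Y (suc k) →
    HasDeg (nonvanishing x X Y) k → HasDeg (vanishing x X Y) t → t < k →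
    ∀ m g → DegLt g (suc m) → ¬ IsZero g →
    ¬ ¬ ∃₂ λ u j → u ℕ.+ j ≡ m × HasDeg (compose g m X Y) (u ℕ.* t ℕ.+ j ℕ.* k) ×
                   (¬ valueAt x g m ≈ 0# → u ≡ 0)
  compose-degree x X Y {k} {t} X< Y< z° w° t<k = go
    where
    w = vanishing x X Y
    z = nonvanishing x X Y
    Result : ℕ → Pol → Set ℓ
    Result m g = ∃₂ λ u j → u ℕ.+ j ≡ m × HasDeg (compose g m X Y) (u ℕ.* t ℕ.+ j ℕ.* k) ×
                            (¬ valueAt x g m ≈ 0# → u ≡ 0)
    go : ∀ m g → DegLt g (suc m) → ¬ IsZero g → ¬ ¬ Result m g
    go zero    g g< g≉0 none =
      none (0 , 0 , ≡.refl , HasDeg-const (λ g₀≈0 → g≉0 λ n → DegLt-pred g g< g₀≈0 n z≤n) , λ _ → ≡.refl)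
    go (suc m) g g< g≉0 none = ¬¬-excluded-middle λ where
        -- The form is divisible by `w`: one zero at `x` is split off, contributing degree `t`, and
        -- the rest is handled by induction.
        (yes r≈0) → go m g′ (quotientAt-DegLt x g g< r≈0) (g≉0 ∘ quotientAt-zero x g r≈0)
          λ (u , j , u+j≡m , C′° , _) → none
            ( suc u , j , ≡.cong suc u+j≡m
            , HasDeg-resp {w *ₚ C′} {compose g (suc m) X Y} (λ n → sym (vanish r≈0 n))
                (≡.subst (HasDeg (w *ₚ C′)) (≡.sym (ℕ.+-assoc t (u ℕ.* t) (j ℕ.* k)))
                  (HasDeg-* w C′ w° C′°))
            , λ r≉0 → contradiction r≈0 r≉0 )
        -- The form does not vanish at `x`. Since `t < k`, the multiple of `w` has degree below that
        -- of the power of `z`, so `top` determines the degree.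
        (no r≉0) → none
          ( 0 , suc m , ≡.refl
          , HasDeg-resp {(w *ₚ C′) +ₚ top} {compose g (suc m) X Y} (λ n → sym (split n))
              (HasDeg-+ʳ (w *ₚ C′) top
                (DegLt-mono {w *ₚ C′} below
                  (DegLt-* w C′ (proj₂ w°) (compose-DegLt X Y X< Y< g′ m)))
                (HasDeg-* (const r) (z ^ᵖ suc m) (HasDeg-const r≉0) (HasDeg-^ z z° (suc m))))
          , λ _ → ≡.refl )
      where
      g′ = quotientAt x g
      C′ = compose g′ m X Y
      r = valueAt x g (suc m)
      top = const r *ₚ (z ^ᵖ suc m)
      split : compose g (suc m) X Y ≈ₚ ((w *ₚ C′) +ₚ top)
      split = compose-split x g m X Y g<
      vanish : r ≈ 0# → compose g (suc m) X Y ≈ₚ (w *ₚ C′)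
      vanish r≈0 = drop-zero-term polynomialRing
        {compose g (suc m) X Y} {w *ₚ C′} {const r} {z ^ᵖ suc m} split (const-zero r≈0)
      below : t ℕ.+ suc (m ℕ.* k) ≤ k ℕ.+ m ℕ.* k
      below = ≡.subst (_≤ k ℕ.+ m ℕ.* k) (≡.sym (ℕ.+-suc t (m ℕ.* k)))
                (ℕ.+-monoˡ-≤ (m ℕ.* k) t<k)

  -- `x` is the value of `X / Y` at infinity. Since `e` is the degree of the vanishing linear form,
  -- the multiplicity of that value is the difference `(s ⊔ t) ∸ e`.
  valueAtInfinity : ∀ X Y {s t} → Coprime X Y → HasDeg X s → HasDeg Y t → 1 ≤ s ℕ.⊔ t →
    ¬ ¬ ∃₂ λ x e → HasDeg (nonvanishing x X Y) (s ℕ.⊔ t) × HasDeg (vanishing x X Y) e ×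
                   e < s ℕ.⊔ t
  valueAtInfinity X Y {s} {t} coprime X° Y° 1≤s⊔t none with ℕ.≤-<-connex s t
  ... | inj₂ t<s rewrite ℕ.m≥n⇒m⊔n≡m (ℕ.<⇒≤ t<s) = none (∞ , t , X° , Y° , t<s)
  -- `x` is the ratio of the coefficients of index `t`, hence zero when `s < t`; it makes the top
  -- coefficient of `X - x Y` cancel.
  ... | inj₁ s≤t rewrite ℕ.m≤n⇒m⊔n≡n s≤t with x , Xₜ≈xYₜ ← division (coeff X t) (proj₁ Y°) =
    degree-exists w t (DegLt-pred w w< wₜ≈0) w≉0 λ (e , e<t , w°) → none (fin x , e , Y° , w° , e<t)
    where
    w = vanishing (fin x) X Y
    xY< : DegLt (const x *ₚ Y) (suc t)
    xY< = DegLt-* (const x) Y (DegLt-const x) (proj₂ Y°)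
    w< : DegLt w (suc t)
    w< = DegLt-+ X (-ₚ (const x *ₚ Y)) (DegLt-mono {X} (s≤s s≤t) (proj₂ X°))
           (DegLt-neg (const x *ₚ Y) xY<)
    wₜ≈0 : coeff w t ≈ 0#
    wₜ≈0 = trans (coeff-sub X (const x *ₚ Y) t)
      (sub-zero (trans Xₜ≈xYₜ (sym (coeff-const* x Y t))))
    -- If `X = x Y`, then `Y` divides both `X` and itself, so coprimality forces `t` to be 0.
    w≉0 : ¬ IsZero w
    w≉0 w≈0 = contradiction (≡.subst (1 ≤_) t≡0 1≤s⊔t) λ ()
      where
      Y∣X : Y ∣ₚ X
      Y∣X = const x , λ n → sym (begin
        coeff X n                                          ≈⟨ sub-add commutativeRing _ _ ⟩
        coeff X n - coeff (const x *ₚ Y) n + coeff (const x *ₚ Y) n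
          ≈⟨ +-congʳ (coeff-sub X (const x *ₚ Y) n) ⟨
        coeff w n + coeff (const x *ₚ Y) n                 ≈⟨ +-congʳ (w≈0 n) ⟩
        0# + coeff (const x *ₚ Y) n                        ≈⟨ +-identityˡ _ ⟩
        coeff (const x *ₚ Y) n                             ≈⟨ P.*-comm (const x) Y n ⟩
        coeff (Y *ₚ const x) n                             ∎)
      t≡0 : t ≡ 0
      t≡0 = HasDeg-unique Y Y° (coprime Y Y∣X (oneₚ , P.*-identityʳ Y))

-- Coprime polynomials over `K` have no common zero in an extension field.

module FieldExtension {c₁ ℓ₁ c₂ ℓ₂} (K : Field c₁ ℓ₁) (L : Field c₂ ℓ₂)
  (ι : Field.Carrier K → Field.Carrier L)
  (ι-hom : IsRingHomomorphism (Field.rawRing K) (Field.rawRing L) ι) where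
  private
    module K = Field K
    module ι = IsRingHomomorphism ι-hom
    module PL = Poly (Field.commutativeRing L)
    module P = CommutativeRing (PolynomialRing.polynomialRing K.commutativeRing)
  open Field L hiding (zero)
  open Poly K.commutativeRing
  open PolynomialRing K.commutativeRing
  open FieldPolynomials K
  open SetoidReasoning setoid

  ι-nonzero : ∀ {x} → ¬ x K.≈ K.0# → ¬ ι x ≈ 0#
  ι-nonzero {x} x≉0 ιx≈0 with x⁻¹ , xx⁻¹≈1 ← K.inverse x x≉0 = 1≉0 (begin
    1#            ≈⟨ ι.1#-homo ⟨
    ι K.1#        ≈⟨ ι.⟦⟧-cong xx⁻¹≈1 ⟨
    ι (x K.* x⁻¹) ≈⟨ ι.*-homo x x⁻¹ ⟩
    ι x * ι x⁻¹   ≈⟨ *-congʳ ιx≈0 ⟩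
    0# * ι x⁻¹    ≈⟨ zeroˡ _ ⟩
    0#            ∎)

  coeff-map : ∀ p n → PL.coeff (map ι p) n ≈ ι (coeff p n)
  coeff-map []      n       = sym ι.0#-homo
  coeff-map (a ∷ p) zero    = refl
  coeff-map (a ∷ p) (suc n) = coeff-map p n

  HasDeg-map : ∀ p {n} → HasDeg p n → PL.HasDeg (map ι p) n
  HasDeg-map p {n} (pₙ≉0 , p<) =
    (λ ιpₙ≈0 → ι-nonzero pₙ≉0 (trans (sym (coeff-map p n)) ιpₙ≈0)) ,
    λ m n<m → trans (coeff-map p m) (trans (ι.⟦⟧-cong (p< m n<m)) ι.0#-homo)

  monomial : K.Carrier → ℕ → Pol
  monomial a zero    = const a
  monomial a (suc n) = K.0# ∷ monomial a n

  coeff-monomial : ∀ a n → coeff (monomial a n) n ≡ a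
  coeff-monomial a zero    = ≡.refl
  coeff-monomial a (suc n) = coeff-monomial a n

  DegLt-monomial : ∀ a n → DegLt (monomial a n) (suc n)
  DegLt-monomial a zero    = DegLt-const a
  DegLt-monomial a (suc n) (suc m) (s≤s n<m) = DegLt-monomial a n m n<m

  module _ (y : Carrier) where
    open Evaluation K.commutativeRing (Field.commutativeRing L) ι ι-hom y

    Minimal : ℕ → Set (c₁ Level.⊔ ℓ₁ Level.⊔ ℓ₂)
    Minimal n = ∀ {j} → j < n → ∀ s → HasDeg s j → ¬ evaluate s ≈ 0#

    -- Long division by `r`, one leading term at a time. What remains vanishes at `y` and has degree
    -- below `n`, so by minimality it is zero.
    minimal-∣ : ∀ r n → HasDeg r n → evaluate r ≈ 0# → Minimal n →
                ∀ N f → DegLt f N → evaluate f ≈ 0# → ¬ ¬ (r ∣ₚ f)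
    minimal-∣ r n r° r[y]≈0 minimal N f f< f[y]≈0 r∤f with ℕ.≤-<-connex N n
    ... | inj₁ N≤n = ¬¬-excluded-middle λ where
      (yes f≈0) → r∤f ([] , P.trans {r *ₚ []} {[]} {f} (P.zeroʳ r) (λ m → K.sym (f≈0 m)))
      (no f≉0)  → degree-exists f N f< f≉0 λ (j , j<N , f°) →
        minimal (ℕ.<-≤-trans j<N N≤n) f f° f[y]≈0
    minimal-∣ r n r° r[y]≈0 minimal (suc N) f f< f[y]≈0 r∤f | inj₂ (s≤s n≤N)
      with x , f≈xr ← division (coeff f N) (proj₁ r°) =
      minimal-∣ r n r° r[y]≈0 minimal N f′ f′< f′[y]≈0 λ (q , rq≈f′) →
        r∤f (q +ₚ M , P.trans {r *ₚ (q +ₚ M)} {f′ +ₚ (M *ₚ r)} {f}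
          (P.trans {r *ₚ (q +ₚ M)} {(r *ₚ q) +ₚ (r *ₚ M)} {f′ +ₚ (M *ₚ r)} (P.distribˡ r q M)
            (P.+-cong {r *ₚ q} {f′} {r *ₚ M} {M *ₚ r} rq≈f′ (P.*-comm r M)))
          (P.sym {f} {f′ +ₚ (M *ₚ r)} f≈f′+Mr))
      where
      -- `M *ₚ r` agrees with `f` in the coefficient of index `N`, so subtracting it lowers the
      -- degree bound while the value at `y` stays zero.
      M = monomial x (N ∸ n)
      f′ = f +ₚ (-ₚ (M *ₚ r))
      N∸n+n : (N ∸ n) ℕ.+ n ≡ N
      N∸n+n = ℕ.m∸n+n≡m n≤N
      f≈f′+Mr : f ≈ₚ (f′ +ₚ (M *ₚ r))
      f≈f′+Mr = sub-add (PolynomialRing.polynomialRing K.commutativeRing) f (M *ₚ r)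
      Mr< : DegLt (M *ₚ r) (suc N)
      Mr< = ≡.subst (DegLt (M *ₚ r)) (≡.trans (ℕ.+-suc (N ∸ n) n) (≡.cong suc N∸n+n))
              (DegLt-* M r (DegLt-monomial x (N ∸ n)) (proj₂ r°))
      Mr-top : coeff (M *ₚ r) N K.≈ x K.* coeff r n
      Mr-top = ≡.subst₂ (λ i a → coeff (M *ₚ r) i K.≈ a K.* coeff r n)
        N∸n+n (coeff-monomial x (N ∸ n))
        (coeff-*-top M r (DegLt-monomial x (N ∸ n)) (proj₂ r°))
      f′< : DegLt f′ N
      f′< = DegLt-pred f′ (DegLt-+ f (-ₚ (M *ₚ r)) f< (DegLt-neg (M *ₚ r) Mr<))
        (K.trans (coeff-sub f (M *ₚ r) N) (sub-zero (K.trans f≈xr (K.sym Mr-top))))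
      f′[y]≈0 : evaluate f′ ≈ 0#
      f′[y]≈0 = begin
        evaluate f′
          ≈⟨ +-identityʳ _ ⟨
        evaluate f′ + 0#
          ≈⟨ +-congˡ (trans (evaluate-* M r) (zero-product (Field.commutativeRing L) r[y]≈0)) ⟨
        evaluate f′ + evaluate (M *ₚ r)
          ≈⟨ evaluate-+ f′ (M *ₚ r) ⟨
        evaluate (f′ +ₚ (M *ₚ r))
          ≈⟨ evaluate-cong f (f′ +ₚ (M *ₚ r)) f≈f′+Mr ⟨
        evaluate f
          ≈⟨ f[y]≈0 ⟩
        0# ∎

    degree-zero-nonvanishing : ∀ r → HasDeg r 0 → ¬ evaluate r ≈ 0#
    degree-zero-nonvanishing r r° = FieldPolynomials.degree-zero-rootless L (map ι r) y (HasDeg-map r r°)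

    -- A polynomial over K of minimal degree vanishing at y would divide both f₁ and f₂.
    coprime⇒noCommonZero : ∀ f₁ f₂ {a} → Coprime f₁ f₂ → HasDeg f₁ a →
                           evaluate f₁ ≈ 0# → ¬ evaluate f₂ ≈ 0#
    coprime⇒noCommonZero f₁ f₂ coprime f₁° f₁[y]≈0 f₂[y]≈0 =
      -- Strong induction on the degree: its hypothesis at `n` is exactly `Minimal n`.
      <-rec (λ n → ∀ r → HasDeg r n → ¬ evaluate r ≈ 0#) step _ f₁ f₁° f₁[y]≈0
      where
      step : ∀ n → Minimal n → ∀ r → HasDeg r n → ¬ evaluate r ≈ 0#
      step n minimal r r° r[y]≈0 =
        minimal-∣ r n r° r[y]≈0 minimal (length f₁) f₁ (DegLt-length f₁) f₁[y]≈0 λ r∣f₁ →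
        minimal-∣ r n r° r[y]≈0 minimal (length f₂) f₂ (DegLt-length f₂) f₂[y]≈0 λ r∣f₂ →
        degree-zero-nonvanishing r (coprime r r∣f₁ r∣f₂) r[y]≈0

-- Arithmetic of the degrees and of the prime `p`.

open import Data.Integer using (+_; _-_; ∣_∣)
open import Data.Integer.Divisibility using (_∣_)
import Data.Integer.Properties as ℤ

∣⇒zero : ∀ {p d n} → p > d → n ≤ d → p ℕ.∣ n → n ≡ 0
∣⇒zero {n = zero}  p>d n≤d p∣n = ≡.refl
∣⇒zero {n = suc n} p>d n≤d p∣n = contradiction p∣n (ℕ.>⇒∤ (ℕ.≤-<-trans n≤d p>d))

-- Each factor is a proper divisor of the product because the other one is at least 2.
factors≤gpd : ∀ {m k d} → 2 ≤ m → 2 ≤ k → GreatestProperDivisor (m ℕ.* k) d → m ≤ d × k ≤ d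
factors≤gpd {m@(suc _)} {k@(suc _)} 2≤m 2≤k (_ , _ , _ , greatest) =
  greatest m (ℕ.m∣m*n k) (s≤s z≤n) (ℕ.m<m*n m k 2≤k) ,
  greatest k (ℕ.n∣m*n m) (s≤s z≤n) (≡.subst (k <_) (ℕ.*-comm k m) (ℕ.m<m*n k m 2≤m))

small-product-zero : ∀ {m k u e d p} → 2 ≤ m → 2 ≤ k → GreatestProperDivisor (m ℕ.* k) d →
  Prime p → p > d → u ≤ m → e ≤ k → p ℕ.∣ u ℕ.* e → u ℕ.* e ≡ 0
small-product-zero {u = u} {e} 2≤m 2≤k gpd p-prime p>d u≤m e≤k p∣ue
  with m≤d , k≤d ← factors≤gpd 2≤m 2≤k gpd | euclidsLemma u e p-prime p∣ue
... | inj₁ p∣u rewrite ∣⇒zero p>d (ℕ.≤-trans u≤m m≤d) p∣u = ≡.refl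
... | inj₂ p∣e rewrite ∣⇒zero p>d (ℕ.≤-trans e≤k k≤d) p∣e = ℕ.*-zeroʳ u

∣+a-+b∣ : ∀ a x → ∣ (+ a) - (+ (a ℕ.+ x)) ∣ ≡ x
∣+a-+b∣ a x = ≡.trans (≡.cong ∣_∣ (ℤ.[+m]-[+n]≡m⊖n a (a ℕ.+ x)))
  (≡.trans (ℤ.∣⊖∣-≤ (ℕ.m≤m+n a x)) (ℕ.m+n∸m≡n a x))

-- Each of the `u` factors of degree `t` falls short of degree `k` by `k ∸ t`; the total shortfall
-- will be the absolute value of the order at infinity.
degree-defect : ∀ {u j m t k} → u ℕ.+ j ≡ m → t ≤ k →
                (u ℕ.* t ℕ.+ j ℕ.* k) ℕ.+ u ℕ.* (k ∸ t) ≡ m ℕ.* k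
degree-defect {u} {j} {m} {t} {k} ≡.refl t≤k = ≡.trans
  (solve 5 (λ u t j k e → (u :* t :+ j :* k) :+ u :* e := u :* (t :+ e) :+ j :* k)
    ≡.refl u t j k (k ∸ t))
  (≡.trans (≡.cong (λ s → u ℕ.* s ℕ.+ j ℕ.* k) (ℕ.m+[n∸m]≡n t≤k)) (≡.sym (ℕ.*-distribʳ-+ k u j)))
  where open +-*-Solver

-- With `u ≡ 0` the degree `a` attains `m * k`, so `a ⊔ b` is `m * k` and `b` falls short of it by
-- `u′ * (k ∸ t)`. This product is divisible by `p`, and `small-product-zero` makes it vanish.
prime-divides-defect : ∀ {m k u j u′ j′ t d p a b} → 2 ≤ m → 2 ≤ k → t < k →
  u ℕ.+ j ≡ m → u′ ℕ.+ j′ ≡ m → u ≡ 0 →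
  a ≡ u ℕ.* t ℕ.+ j ℕ.* k → b ≡ u′ ℕ.* t ℕ.+ j′ ℕ.* k →
  GreatestProperDivisor (a ⊔ b) d → Prime p → p > d → (+ p) ∣ ((+ b) - (+ a)) → b ≡ a
prime-divides-defect {m} {k} {u′ = u′} {j′} {t} {d} {p} {a} {b}
  2≤m 2≤k t<k ≡.refl u′+j′≡m ≡.refl a≡ b≡ gpd p-prime p>d p∣b-a =
  ≡.trans (≡.sym (ℕ.+-identityʳ b)) (≡.trans (≡.cong (b ℕ.+_) (≡.sym x≡0)) b+x≡a)
  where
  x = u′ ℕ.* (k ∸ t)
  b+x≡a : b ℕ.+ x ≡ a
  b+x≡a = ≡.trans (≡.cong (ℕ._+ x) b≡)
    (≡.trans (degree-defect {u′} {j′} u′+j′≡m (ℕ.<⇒≤ t<k)) (≡.sym a≡))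
  a⊔b≡mk : a ⊔ b ≡ m ℕ.* k
  a⊔b≡mk = ≡.trans (ℕ.m≥n⇒m⊔n≡m (≡.subst (b ≤_) b+x≡a (ℕ.m≤m+n b x))) a≡
  x≡0 : x ≡ 0
  x≡0 = small-product-zero 2≤m 2≤k (≡.subst (λ n → GreatestProperDivisor n d) a⊔b≡mk gpd)
    p-prime p>d (≡.subst (u′ ≤_) u′+j′≡m (ℕ.m≤m+n u′ j′)) (ℕ.m∸n≤m k t)
    (≡.subst (p ℕ.∣_) (≡.trans (≡.cong (λ c → ∣ (+ b) - (+ c) ∣) (≡.sym b+x≡a)) (∣+a-+b∣ b x)) p∣b-a)

-- Comparison of `f` with a supposed decomposition.

theorem3p10 : ∀ {c₁ ℓ₁ c₂ ℓ₂ : Level} (K : Field c₁ ℓ₁) (Kbar : Field c₂ ℓ₂)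
    (ι : Field.Carrier K → Field.Carrier Kbar) → IsAlgebraicClosure K Kbar ι →
    (f₁ f₂ : Poly.Pol (Field.commutativeRing K)) →
    Poly.Coprime (Field.commutativeRing K) f₁ f₂ →
    (a b : ℕ) → Poly.HasDeg (Field.commutativeRing K) f₁ a →
    Poly.HasDeg (Field.commutativeRing K) f₂ b →
    (d : ℕ) → GreatestProperDivisor (a ⊔ b) d →
    ¬ ((+ b) - (+ a) ≡ + 0) →
    (p : ℕ) → Prime p → p > d → (+ p) ∣ ((+ b) - (+ a)) →
    PrimeOver Kbar (map ι f₁) (map ι f₂)
theorem3p10 K Kbar ι closure f₁ f₂ f-coprime a b f₁° f₂° d gpd b-a≢0 p p-prime p>d p∣b-a
  (g₁ , g₂ , h₁ , h₂ , m , n ,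
   (g-coprime , α , β , g₁° , g₂° , m≡α⊔β) , 2≤m , (h-coprime , s , t , h₁° , h₂° , ≡.refl) , 2≤n ,
   _ , f₁D≈f₂N) = valueAtInfinity h₁ h₂ h-coprime h₁° h₂° (ℕ.<⇒≤ 2≤n) λ (x , e , z° , w° , e<n) →
    -- The goal is `⊥`, so results under a double negation are used by passing the rest of the
    -- argument as a continuation.
    compose-degree x h₁ h₂ h₁< h₂< z° w° e<n m g₁ g₁< (HasDeg⇒nonzero {g₁} g₁°)
      λ (u , j , u+j≡m , N° , u≡0) →
    compose-degree x h₁ h₂ h₁< h₂< z° w° e<n m g₂ g₂< (HasDeg⇒nonzero {g₂} g₂°)
      λ (u′ , j′ , u′+j′≡m , D° , u′≡0) →
    -- Neither `F₁ / F₂` nor `N / D` has a common root above and below, so `degree-≤` applies in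
    -- both directions and the degrees agree.
    let a≡ = ℕ.≤-antisym (degree-≤ F₁ F₂ N D a _ F₁° N° f-noRoot F₁D≈F₂N)
                         (degree-≤ N D F₁ F₂ _ a N° F₁° N-noRoot (swap N F₂ D F₁ F₁D≈F₂N))
        b≡ = ℕ.≤-antisym (degree-≤ F₂ F₁ D N b _ F₂° D° (flip-noRoot F₁ F₂ f-noRoot)
                           (L[x].sym {F₁ *ₚ D} {F₂ *ₚ N} F₁D≈F₂N))
                         (degree-≤ D N F₂ F₁ _ b D° F₂° (flip-noRoot N D N-noRoot)
                           (swap D F₁ N F₂ (L[x].sym {F₁ *ₚ D} {F₂ *ₚ N} F₁D≈F₂N)))
    in ¬¬-excluded-middle λ where
      -- `g₁` does not vanish at `x`, so the numerator has full degree and only the denominator can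
      -- fall short.
      (no r≉0)  → b-a≢0 (ℤ.i≡j⇒i-j≡0 (≡.cong +_
        (prime-divides-defect {u = u} {u′ = u′} 2≤m 2≤n e<n u+j≡m u′+j′≡m (u≡0 r≉0) a≡ b≡ gpd p-prime p>d p∣b-a)))
      -- `g₁` vanishes at `x`, so by coprimality `g₂` does not, and the roles of numerator and
      -- denominator are exchanged.
      (yes r≈0) → b-a≢0 (ℤ.i≡j⇒i-j≡0 (≡.cong +_ (≡.sym
        (prime-divides-defect {u = u′} {u′ = u} 2≤m 2≤n e<n u′+j′≡m u+j≡m (u′≡0 (r′≉0 x r≈0)) b≡ a≡
          (≡.subst (λ n → GreatestProperDivisor n d) (ℕ.⊔-comm a b) gpd) p-prime p>d
          (≡.subst (p ℕ.∣_) (ℤ.∣i-j∣≡∣j-i∣ (+ b) (+ a)) p∣b-a)))))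
  where
  open IsAlgebraicClosure closure
  open FieldExtension K Kbar ι isRingHom
  open Field Kbar using (_≈_; 0#; commutativeRing)
  open Poly commutativeRing
  open PolynomialRing commutativeRing
  open FieldPolynomials Kbar hiding (degree-≤)
  open Composition Kbar
  module L[x] = CommutativeRing polynomialRing
  degree-≤ = FieldPolynomials.degree-≤ Kbar algClosed
  F₁ = map ι f₁
  F₂ = map ι f₂
  F₁° = HasDeg-map f₁ f₁°
  F₂° = HasDeg-map f₂ f₂°
  N = compose g₁ m h₁ h₂
  D = compose g₂ m h₁ h₂
  h₁< : DegLt h₁ (suc (s ⊔ t))
  h₁< = DegLt-mono {h₁} (s≤s (ℕ.m≤m⊔n s t)) (proj₂ h₁°)
  h₂< : DegLt h₂ (suc (s ⊔ t))
  h₂< = DegLt-mono {h₂} (s≤s (ℕ.m≤n⊔m s t)) (proj₂ h₂°)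
  g₁< : DegLt g₁ (suc m)
  g₁< = DegLt-mono {g₁} (s≤s (≡.subst (α ≤_) (≡.sym m≡α⊔β) (ℕ.m≤m⊔n α β))) (proj₂ g₁°)
  g₂< : DegLt g₂ (suc m)
  g₂< = DegLt-mono {g₂} (s≤s (≡.subst (β ≤_) (≡.sym m≡α⊔β) (ℕ.m≤n⊔m α β))) (proj₂ g₂°)
  r′≉0 : ∀ x → valueAt x g₁ m ≈ 0# → ¬ valueAt x g₂ m ≈ 0#
  r′≉0 x rewrite m≡α⊔β = valueAt-coprime g₁ g₂ g-coprime g₁° g₂° x
  -- Coprimality of `f₁` and `f₂` is given over `K`, whereas the roots lie in `Kbar`.
  f-noRoot : NoCommonRoot F₁ F₂
  f-noRoot y = coprime⇒noCommonZero y f₁ f₂ f-coprime f₁°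
  flip-noRoot : ∀ P Q → NoCommonRoot P Q → NoCommonRoot Q P
  flip-noRoot P Q noRoot y Q≈0 P≈0 = noRoot y P≈0 Q≈0
  N-noRoot : NoCommonRoot N D
  N-noRoot = nonconstant m 2≤m m≡α⊔β
    where
    nonconstant : ∀ m → 2 ≤ m → m ≡ α ⊔ β → NoCommonRoot (compose g₁ m h₁ h₂) (compose g₂ m h₁ h₂)
    nonconstant (suc m) _ m≡ = compose-noCommonRoot g₁ g₂ g-coprime g₁° g₂° h₁ h₂ (≡.sym m≡)
      (coprime⇒noCommonRoot h₁ h₂ h-coprime)
  F₁D≈F₂N : (F₁ *ₚ D) ≈ₚ (F₂ *ₚ N)
  F₁D≈F₂N = L[x].trans {F₁ *ₚ D} {F₁ *ₚ homog g₂ m h₁ h₂} {F₂ *ₚ N}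
    (L[x].*-congˡ {F₁} {D} {homog g₂ m h₁ h₂}
      (L[x].sym {homog g₂ m h₁ h₂} {D} (homog≈compose g₂ m h₁ h₂)))
    (L[x].trans {F₁ *ₚ homog g₂ m h₁ h₂} {F₂ *ₚ homog g₁ m h₁ h₂} {F₂ *ₚ N} f₁D≈f₂N
      (L[x].*-congˡ {F₂} {homog g₁ m h₁ h₂} {N} (homog≈compose g₁ m h₁ h₂)))
  swap : ∀ P Q R S → (S *ₚ R) ≈ₚ (Q *ₚ P) → (P *ₚ Q) ≈ₚ (R *ₚ S)
  swap P Q R S SR≈QP = L[x].trans {P *ₚ Q} {Q *ₚ P} {R *ₚ S} (L[x].*-comm P Q)
    (L[x].trans {Q *ₚ P} {S *ₚ R} {R *ₚ S} (L[x].sym {S *ₚ R} {Q *ₚ P} SR≈QP) (L[x].*-comm S R))
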